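{- Let $E[X]$ be a term of $\Pi^D_1$, let $m$ be a fresh name and $Tr_m := \langle Z\rangle\overline{m}Z$. For every $A$ of abstraction type: (1) if $E[Tr_m]$ is non-parameterized (not an abstraction), then $E[A]\approx (m)(E[Tr_m]\,|\,!m(Z).A\langle Z\rangle)$; (2) if $E[Tr_m]\equiv\langle Y_1\rangle\cdots\langle Y_k\rangle E'$ for some $k\ge 1$ and non-parameterized $E'$, then $E[A]\approx\langle Y_1\rangle\cdots\langle Y_k\rangle\big((m)(E'\,|\,!m(Z).A\langle Z\rangle)\big)$.
   Context: The calculus $\Pi^D_1$: terms $T ::= 0 \mid X \mid a(X).T \mid \overline{a}T'.T \mid T\,|\,T' \mid (c)T \mid \langle X\rangle T \mid T\langle T'\rangle$ over channel names $a,b,c,m,\dots$ and process variables $X,Y,Z$; $a(X).T$ and $\langle X\rangle T$ bind $X$, $(c)T$ binds $c$. Processes are well-typed and strictly abstraction-passing (all transmitted objects and all variables have abstraction type). $E[X]$ is a term with distinguished variable $X$ and $E[A]$ is the capture-avoiding substitution $E\{A/X\}$; a fresh name does not occur in the terms considered. $\overline{m}Z$ abbreviates $\overline{m}Z.0$. Replication is derived: $!\phi.P := (c)(Q_c\,|\,\overline{c}Q_c)$, $Q_c := c(X).(\phi.(X\,|\,P)\,|\,\overline{c}X)$ with $c$ fresh. Structural congruence $\equiv$ comprises $\alpha$-conversion, monoid laws for $|$ with unit $0$, $(c)(d)T\equiv(d)(c)T$, $(c)\lambda.T\equiv0$ when $c$ is the subject of $\lambda$, scope extrusion $(c)(T|T')\equiv(c)T|T'$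 for $c\notin fn(T')$, and $(\langle X\rangle T)\langle T'\rangle\equiv T\{T'/X\}$. The labelled transition semantics is the standard early higher-order one: $a(X).T\xrightarrow{a(A)}T\{A/X\}$; $\overline{a}A.T\xrightarrow{\overline{a}A}T$; restriction of non-involved names; $(d)T\xrightarrow{(d\vec c)\overline{a}A}T'$ from $T\xrightarrow{(\vec c)\overline{a}A}T'$ when $d\in fn(A)\setminus\{\vec c,a\}$; parallel interleaving with $bn(\lambda)\cap fn(T_1)=\emptyset$; communication $T_1|T_2\xrightarrow{\tau}(\vec c)(T_1'|T_2')$ from $T_1\xrightarrow{a(A)}T_1'$, $T_2\xrightarrow{(\vec c)\overline{a}A}T_2'$; transitions closed under $\equiv$. Weak transitions $\Rightarrow$, $\stackrel{\lambda}{\Rightarrow}$, $\stackrel{\hat\lambda}{\Rightarrow}$ as usual. Context bisimilarity $\approx$ is the largest symmetric relation $\mathcal R$ on closed processes such that whenever $P\mathcal R Q$: if $P\xrightarrow{\alpha}P'$ with $\alpha\in\{\tau,a(A)\}$ then $Q\stackrel{\hat\alpha}{\Rightarrow}Q'$ with $P'\mathcal RQ'$; and if $P\xrightarrow{(\vec c)\overline{a}A}P'$ then $Q\stackrel{(\vec d)\overline{a}B}{\Rightarrow}Q'$ with $(\vec c)(E[A]|P')\,\mathcal R\,(\vec d)(E[B]|Q')$ for every $E[X]$ with $\{\vec c,\vec d\}\cap fn(E)=\emptyset$. It is extended to open terms by $T\approx T'$ iff $T\{\vec A/\vec X\}\approx T'\{\vec A/\vec X\}$ for all closed $\vec A$ (where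 $fv(T,T')\subseteq\vec X$), and to abstractions by $\langle\vec X\rangle T\approx\langle\vec X\rangle T'$ iff $T\{\vec A/\vec X\}\approx T'\{\vec A/\vec X\}$ for all closed $\vec A$. -}

module Defs where

open import Data.List using (List; []; _∷_; _ʳ++_) renaming (map to mapᴸ)
open import Data.List.Membership.Propositional using (_∈_)
open import Data.List.Relation.Binary.Subset.Propositional using (_⊆_)
open import Data.List.Relation.Binary.Subset.Propositional.Properties using (∷⁺ʳ)
open import Data.List.Relation.Unary.Any using (here; there)
open import Data.Nat using (ℕ)
open import Data.Product using (Σ; ∃; _×_; _,_)
open import Function using (id; _∘_)
open import Level using (0ℓ)
open import Relation.Binary using (Rel; Symmetric)
open import Relation.Binary.Construct.Closure.ReflexiveTransitive using (Star)
open import Relation.Binary.PropositionalEquality using (_≡_; refl)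

data Ty (Abs : Set) : Set where
  ◇  : Ty Abs
  ↑_ : Abs → Ty Abs

-- An arbitrary strictly abstraction-passing type discipline: α stands for
-- the type of abstractions over a variable of type dom α with a body of type
-- cod α.  Since every parameter is itself of abstraction type, no such
-- discipline consists of finite (simple) types; presenting it by dom and cod
-- admits recursive types, e.g. Abs = ⊤ with the single type D = D → ◇.
record TypeStructure : Set₁ where
  field
    Abs : Set
    dom : Abs → Abs
    cod : Abs → Ty Abs

module Calculus (𝒯 : TypeStructure) where
  open TypeStructure 𝒯 public

  Type : Set
  Type = Ty Abs

  Ctx : Set
  Ctx = List Type

  -- Sequences of binders (channels c⃗ or parameters X⃗) are listed outermost
  -- first, so a body under Θ lives in the context Θ ʳ++ Δ.

  weakens : ∀ {Δ : Ctx} Θ → Δ ⊆ Θ ʳ++ Δ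
  weakens []      = id
  weakens (s ∷ Θ) = weakens Θ ∘ there

  lifts : ∀ {Δ Δ' : Ctx} Θ → Δ ⊆ Δ' → Θ ʳ++ Δ ⊆ Θ ʳ++ Δ'
  lifts []      ρ = ρ
  lifts (s ∷ Θ) ρ = lifts Θ (∷⁺ʳ s ρ)

  swap : ∀ {s t} {Δ : Ctx} → s ∷ t ∷ Δ ⊆ t ∷ s ∷ Δ
  swap (here p)          = there (here p)
  swap (there (here p))  = here p
  swap (there (there x)) = there (there x)

  moveOut : ∀ {s} {Δ : Ctx} Θ → Θ ʳ++ (s ∷ Δ) ⊆ s ∷ (Θ ʳ++ Δ)
  moveOut []      = id
  moveOut (t ∷ Θ) = moveOut Θ ∘ lifts Θ swap

  -- Chan Δ s: channels carrying objects of type s.  Restricted channels are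
  -- de Bruijn indices into Δ; the free names form a countable supply at every
  -- abstraction type, disjoint from Δ.  Free names never carry processes, so
  -- all visible communications are abstraction-passing.  Only a restricted
  -- channel may have sort ◇: the derived replication sends a process on its
  -- private channel c.
  data Chan (Δ : Ctx) : Type → Set where
    free  : ∀ {α} → ℕ → Chan Δ (↑ α)
    bound : ∀ {s} → s ∈ Δ → Chan Δ s

  -- Term Δ Γ t: well-typed terms with restricted channels in Δ and variables
  -- in Γ, up to α-conversion.
  data Term (Δ Γ : Ctx) : Type → Set where
    𝟎   : Term Δ Γ ◇
    var : ∀ {t} → t ∈ Γ → Term Δ Γ t
    inp : ∀ {s} → Chan Δ s → Term Δ (s ∷ Γ) ◇ → Term Δ Γ ◇
    out : ∀ {s} → Chan Δ s → Term Δ Γ s → Term Δ Γ ◇ → Term Δ Γ ◇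
    _∥_ : Term Δ Γ ◇ → Term Δ Γ ◇ → Term Δ Γ ◇
    ν   : ∀ s → Term (s ∷ Δ) Γ ◇ → Term Δ Γ ◇
    lam : ∀ {α t} → cod α ≡ t → Term Δ (↑ dom α ∷ Γ) t → Term Δ Γ (↑ α)
    app : ∀ {α t} → cod α ≡ t → Term Δ Γ (↑ α) → Term Δ Γ (↑ dom α) → Term Δ Γ t

  infixr 6 _∥_

  renᶜ : ∀ {Δ Δ' s} → Δ ⊆ Δ' → Chan Δ s → Chan Δ' s
  renᶜ ρ (free k)  = free k
  renᶜ ρ (bound x) = bound (ρ x)

  ren : ∀ {Δ Δ' Γ Γ' t} → Δ ⊆ Δ' → Γ ⊆ Γ' → Term Δ Γ t → Term Δ' Γ' t
  ren ρ ξ 𝟎           = 𝟎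
  ren ρ ξ (var x)     = var (ξ x)
  ren ρ ξ (inp a T)   = inp (renᶜ ρ a) (ren ρ (∷⁺ʳ _ ξ) T)
  ren ρ ξ (out a O T) = out (renᶜ ρ a) (ren ρ ξ O) (ren ρ ξ T)
  ren ρ ξ (T ∥ U)     = ren ρ ξ T ∥ ren ρ ξ U
  ren ρ ξ (ν s T)     = ν s (ren (∷⁺ʳ s ρ) ξ T)
  ren ρ ξ (lam e T)   = lam e (ren ρ (∷⁺ʳ _ ξ) T)
  ren ρ ξ (app e T U) = app e (ren ρ ξ T) (ren ρ ξ U)

  Sub : Ctx → Ctx → Ctx → Set
  Sub Δ Γ Γ' = ∀ {t} → t ∈ Γ → Term Δ Γ' t

  liftᵛ : ∀ {Δ Γ Γ' s} → Sub Δ Γ Γ' → Sub Δ (s ∷ Γ) (s ∷ Γ')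
  liftᵛ σ (here p)  = var (here p)
  liftᵛ σ (there x) = ren id there (σ x)

  liftᶜ : ∀ {Δ Γ Γ' s} → Sub Δ Γ Γ' → Sub (s ∷ Δ) Γ Γ'
  liftᶜ σ x = ren there id (σ x)

  sub : ∀ {Δ Γ Γ' t} → Sub Δ Γ Γ' → Term Δ Γ t → Term Δ Γ' t
  sub σ 𝟎           = 𝟎
  sub σ (var x)     = σ x
  sub σ (inp a T)   = inp a (sub (liftᵛ σ) T)
  sub σ (out a O T) = out a (sub σ O) (sub σ T)
  sub σ (T ∥ U)     = sub σ T ∥ sub σ U
  sub σ (ν s T)     = ν s (sub (liftᶜ σ) T)
  sub σ (lam e T)   = lam e (sub (liftᵛ σ) T)
  sub σ (app e T U) = app e (sub σ T) (sub σ U)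

  single : ∀ {Δ Γ s} → Term Δ Γ s → Sub Δ (s ∷ Γ) Γ
  single A (here refl) = A
  single A (there x)   = var x

  _[_] : ∀ {Δ Γ s t} → Term Δ (s ∷ Γ) t → Term Δ Γ s → Term Δ Γ t
  E [ A ] = sub (single A) E

  infixl 8 _[_]

  ν* : ∀ {Δ Γ} Θ → Term (Θ ʳ++ Δ) Γ ◇ → Term Δ Γ ◇
  ν* []      T = T
  ν* (s ∷ Θ) T = ν s (ν* Θ T)

  data _∈fn_ {Δ : Ctx} {s : Type} (x : s ∈ Δ) {Γ : Ctx} : ∀ {t} → Term Δ Γ t → Set where
    inp-subject : ∀ {T} → x ∈fn inp (bound x) T
    inp-cont    : ∀ {u} {a : Chan Δ u} {T} → x ∈fn T → x ∈fn inp a T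
    out-subject : ∀ {O T} → x ∈fn out (bound x) O T
    out-object  : ∀ {u} {a : Chan Δ u} {O T} → x ∈fn O → x ∈fn out a O T
    out-cont    : ∀ {u} {a : Chan Δ u} {O T} → x ∈fn T → x ∈fn out a O T
    par-l       : ∀ {T U} → x ∈fn T → x ∈fn (T ∥ U)
    par-r       : ∀ {T U} → x ∈fn U → x ∈fn (T ∥ U)
    res         : ∀ {u T} → there x ∈fn T → x ∈fn ν u T
    lam-body    : ∀ {α t} {e : cod α ≡ t} {T} → x ∈fn T → x ∈fn lam e T
    app-l       : ∀ {α t} {e : cod α ≡ t} {T U} → x ∈fn T → x ∈fn app e T U
    app-r       : ∀ {α t} {e : cod α ≡ t} {T U} → x ∈fn U → x ∈fn app e T U

  newest : ∀ {s Δ} → Chan (s ∷ Δ) s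
  newest = bound (here refl)

  infix 4 _≣_

  data _≣_ {Δ Γ : Ctx} : ∀ {t} → Term Δ Γ t → Term Δ Γ t → Set where
    ≣-refl  : ∀ {t} {T : Term Δ Γ t} → T ≣ T
    ≣-sym   : ∀ {t} {T U : Term Δ Γ t} → T ≣ U → U ≣ T
    ≣-trans : ∀ {t} {T U V : Term Δ Γ t} → T ≣ U → U ≣ V → T ≣ V

    inp-cong : ∀ {s} {a : Chan Δ s} {T T'} → T ≣ T' → inp a T ≣ inp a T'
    out-cong : ∀ {s} {a : Chan Δ s} {O O' T T'} → O ≣ O' → T ≣ T' → out a O T ≣ out a O' T'
    ∥-cong   : ∀ {T T' U U'} → T ≣ T' → U ≣ U' → T ∥ U ≣ T' ∥ U'
    ν-cong   : ∀ {s T T'} → T ≣ T' → ν s T ≣ ν s T'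
    lam-cong : ∀ {α t} {e : cod α ≡ t} {T T'} → T ≣ T' → lam e T ≣ lam e T'
    app-cong : ∀ {α t} {e : cod α ≡ t} {T T' U U'} → T ≣ T' → U ≣ U' → app e T U ≣ app e T' U'

    ∥-assoc    : ∀ {T U V} → (T ∥ U) ∥ V ≣ T ∥ (U ∥ V)
    ∥-comm     : ∀ {T U} → T ∥ U ≣ U ∥ T
    ∥-identity : ∀ {T} → T ∥ 𝟎 ≣ T

    ν-swap    : ∀ {s t T} → ν s (ν t T) ≣ ν t (ν s (ren swap id T))
    ν-inp     : ∀ {s T} → ν s (inp newest T) ≣ 𝟎
    ν-out     : ∀ {s O T} → ν s (out newest O T) ≣ 𝟎
    ν-extrude : ∀ {s T U} → ν s (T ∥ ren there id U) ≣ ν s T ∥ U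
    β         : ∀ {α t} {e : cod α ≡ t} {T U} → app e (lam e T) U ≣ T [ U ]

  Closed : Ctx → Type → Set
  Closed Δ t = Term Δ [] t

  -- Act Δ Θ: actions with bound names Θ; send Θ a A is (Θ)āA, whose object
  -- may mention Θ while its subject may not.
  data Act (Δ : Ctx) : Ctx → Set where
    τ    : Act Δ []
    recv : ∀ {s} → Chan Δ s → Closed Δ s → Act Δ []
    send : ∀ {s} Θ → Chan Δ s → Closed (Θ ʳ++ Δ) s → Act Δ Θ

  infix 4 _—[_]→_ _⇒_ _=[_]⇒_

  -- Side conditions such as bn(λ) ∩ fn(T) = ∅ appear as weakenings.
  data _—[_]→_ {Δ : Ctx} : ∀ {Θ} → Closed Δ ◇ → Act Δ Θ → Closed (Θ ʳ++ Δ) ◇ → Set where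
    INP : ∀ {s} {a : Chan Δ s} {T A} → inp a T —[ recv a A ]→ T [ A ]
    OUT : ∀ {s} {a : Chan Δ s} {A T} → out a A T —[ send [] a A ]→ T
    RES-τ : ∀ {d T T'} → T —[ τ ]→ T' → ν d T —[ τ ]→ ν d T'
    RES-recv : ∀ {d s} {a : Chan Δ s} {A T T'} →
      T —[ recv (renᶜ there a) (ren there id A) ]→ T' →
      ν d T —[ recv a A ]→ ν d T'
    RES-send : ∀ {d s Θ} {a : Chan Δ s} {A : Closed (Θ ʳ++ Δ) s} {T T'} →
      T —[ send Θ (renᶜ there a) (ren (lifts Θ there) id A) ]→ T' →
      ν d T —[ send Θ a A ]→ ν d (ren (moveOut Θ) id T')
    OPEN : ∀ {d s Θ} {a : Chan Δ s} {A : Closed (Θ ʳ++ (d ∷ Δ)) s} {T T'} →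
      weakens {d ∷ Δ} Θ (here refl) ∈fn A →
      T —[ send Θ (renᶜ there a) A ]→ T' →
      ν d T —[ send (d ∷ Θ) a A ]→ T'
    PAR : ∀ {Θ} {l : Act Δ Θ} {T T' U} →
      T —[ l ]→ T' → T ∥ U —[ l ]→ T' ∥ ren (weakens Θ) id U
    COM : ∀ {s Θ} {a : Chan Δ s} {A : Closed (Θ ʳ++ Δ) s} {T T' U U'} →
      ren (weakens Θ) id T —[ recv (renᶜ (weakens Θ) a) A ]→ T' →
      U —[ send Θ a A ]→ U' →
      T ∥ U —[ τ ]→ ν* Θ (T' ∥ U')
    STRUCT : ∀ {Θ} {l : Act Δ Θ} {T T' U U'} →
      T ≣ U → U —[ l ]→ U' → U' ≣ T' → T —[ l ]→ T'

  _⇒_ : ∀ {Δ} → Closed Δ ◇ → Closed Δ ◇ → Set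
  _⇒_ = Star _—[ τ ]→_

  _=[_]⇒_ : ∀ {Δ Θ} → Closed Δ ◇ → Act Δ Θ → Closed (Θ ʳ++ Δ) ◇ → Set
  P =[ l ]⇒ P' = ∃ λ P₁ → ∃ λ P₂ → P ⇒ P₁ × P₁ —[ l ]→ P₂ × P₂ ⇒ P'

  Process : Set
  Process = Closed [] ◇

  -- (Θ)(E[A] | P) with Θ ∩ fn(E) = ∅
  plug : ∀ {s} → Term [] (s ∷ []) ◇ → ∀ Θ → Closed (Θ ʳ++ []) s → Closed (Θ ʳ++ []) ◇ → Process
  plug E Θ A P = ν* Θ (ren (weakens Θ) id E [ A ] ∥ P)

  record IsContextBisimulation (R : Rel Process 0ℓ) : Set where
    field
      symmetric : Symmetric R
      τ-match : ∀ {P Q P'} → R P Q → P —[ τ ]→ P' →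
        ∃ λ Q' → Q ⇒ Q' × R P' Q'
      recv-match : ∀ {P Q P' s} {a : Chan [] s} {A} → R P Q → P —[ recv a A ]→ P' →
        ∃ λ Q' → Q =[ recv a A ]⇒ Q' × R P' Q'
      send-match : ∀ {P Q s Θ} {a : Chan [] s} {A P'} → R P Q → P —[ send Θ a A ]→ P' →
        ∃ λ Θ' → ∃ λ B → ∃ λ Q' → Q =[ send Θ' a B ]⇒ Q' ×
          (∀ (E : Term [] (s ∷ []) ◇) → R (plug E Θ A P') (plug E Θ' B Q'))

  infix 4 _≈ᵖ_ _≈ᶜ_ _≈_

  _≈ᵖ_ : Process → Process → Set₁
  P ≈ᵖ Q = Σ (Rel Process 0ℓ) λ R → IsContextBisimulation R × R P Q

  -- A closed term of abstraction type need not be a syntactic abstraction;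
  -- in that case the instance is the application itself.
  instantiate : ∀ {Δ α} → Closed Δ (↑ α) → Closed Δ (↑ dom α) → Closed Δ (cod α)
  instantiate (lam refl T) B = T [ B ]
  instantiate F            B = app refl F B

  data _≈ᶜ_ : ∀ {t} → Closed [] t → Closed [] t → Set₁ where
    proc : ∀ {P Q} → P ≈ᵖ Q → P ≈ᶜ Q
    abst : ∀ {α} {F G : Closed [] (↑ α)} →
      (∀ B → instantiate F B ≈ᶜ instantiate G B) → F ≈ᶜ G

  _≈_ : ∀ {Γ t} → Term [] Γ t → Term [] Γ t → Set₁
  _≈_ {Γ} T U = (σ : Sub [] Γ []) → sub σ T ≈ᶜ sub σ U

  -- !a(Z).P = (c)(Q | c̄Q) with Q = c(X).(a(Z).(X | P) | c̄X)
  !inp : ∀ {Δ Γ s} → Chan Δ s → Term Δ (s ∷ Γ) ◇ → Term Δ Γ ◇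
  !inp {Δ} {Γ} a P = ν ◇ (Q ∥ out newest Q 𝟎)
    where
    Q : Term (◇ ∷ Δ) Γ ◇
    Q = inp newest
          (inp (renᶜ there a) (var (there (here refl)) ∥ ren there (∷⁺ʳ _ there) P)
            ∥ out newest (var (here refl)) 𝟎)

  Tr : ∀ {Δ Γ α} → cod α ≡ ◇ → Chan Δ (↑ dom α) → Term Δ Γ (↑ α)
  Tr e m = lam e (out m (var (here refl)) 𝟎)

  -- E[Tr_m] for a name m not in E, taken to be the innermost restricted channel
  _[Tr_] : ∀ {Δ Γ α t} → Term Δ (↑ α ∷ Γ) t → cod α ≡ ◇ → Term (↑ dom α ∷ Δ) Γ t
  E [Tr e ] = ren there id E [ Tr e newest ]

  -- (m)(T | !m(Z).A⟨Z⟩) with m not in A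
  serve : ∀ {Δ Γ α} → cod α ≡ ◇ → Term Δ Γ (↑ α) → Term (↑ dom α ∷ Δ) Γ ◇ → Term Δ Γ ◇
  serve {α = α} e A T =
    ν (↑ dom α) (T ∥ !inp newest (app e (ren there there A) (var (here refl))))

  -- Params Ψ t: t is the type of ⟨Y₁⟩⋯⟨Yₖ⟩T for T of type ◇ and Y⃗ of types Ψ
  data Params : Ctx → Type → Set where
    []  : Params [] ◇
    _∷_ : ∀ {α t Ψ} → cod α ≡ t → Params Ψ t → Params (↑ dom α ∷ Ψ) (↑ α)

  lam* : ∀ {Δ Γ Ψ t} → Params Ψ t → Term Δ (Ψ ʳ++ Γ) ◇ → Term Δ Γ t
  lam* []      T = T
  lam* (e ∷ p) T = lam e (lam* p T)

  vars : List Abs → Ctx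
  vars = mapᴸ ↑_

{-# OPTIONS --safe #-}
module Submission where

open import Defs
open import Data.Empty using (⊥; ⊥-elim)
open import Data.List using (List; []; _∷_; _ʳ++_)
open import Data.List.Membership.Propositional using (_∈_)
open import Data.List.Relation.Binary.Subset.Propositional using (_⊆_)
open import Data.List.Relation.Binary.Subset.Propositional.Properties using (∷⁺ʳ)
open import Data.List.Relation.Unary.Any using (here; there)
open import Data.Product using (Σ; ∃; _×_; _,_; proj₁)
open import Data.Sum using (_⊎_; inj₁; inj₂)
open import Data.Unit using (⊤; tt)
open import Function using (id; _∘_)
open import Level using (0ℓ)
open import Relation.Binary using (Rel)
open import Relation.Binary.Construct.Closure.ReflexiveTransitive using (Star; ε; _◅_; _◅◅_; gmap)
open import Relation.Binary.PropositionalEquality using (_≡_; refl; sym; trans; cong; cong₂; subst)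
open import Axiom.UniquenessOfIdentityProofs.WithK using (uip)

-- Structural congruence contains β and its inverse under every prefix, so
-- transitions are first described syntactically: head reduction of the active
-- part of a term, followed by the firing of active prefixes (commitments).
-- Congruent terms have the same commitments: the congruence laws and
-- β-contraction are simulated step by step, and β-expansion by standardisation.
--
-- With that, let T correspond to U when U arises from T by replacing some
-- occurrences of A by Tr_m and some calls A⟨B⟩ by m̄B.  Whenever T runs a copy
-- of A that is a trigger in U, the emitted m̄B is answered by the server, which
-- restores A⟨B⟩; otherwise T and U move alike.  Hence T versus
-- (m)(U | !m(Z).A⟨Z⟩), up to ≣ and with the server idle or unfolded, is a
-- context bisimulation, and E[A] corresponds to E[Tr_m].

-- `STRUCT` may rewrite a process before and after every rule, so inverting a transition reveals
-- little; a commitment is a position in the syntax and can be inverted. A β-expansion resists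
-- stepwise simulation: a head step of the contractum may become available in the expanded term only
-- after further head steps, while other copies of the same redex stay uncontracted in arguments and
-- under prefixes. Standard order keeps these two apart. The correspondence needs pending calls
-- because a trigger applied to B reduces to an output while A⟨B⟩ on the other side does nothing,
-- and it needs genuine copies of A because every answer of the server brings one. Outputs are
-- compared under all receiving contexts at once; a context that avoids m corresponds to its own
-- weakening, so no congruence property of ≈ is required. A can be kept closed: open terms are first
-- closed by a substitution, and abstractions are applied to their parameters before any
-- bisimulation is invoked.

module Proof (𝒯 : TypeStructure) where
  open Calculus 𝒯

  -- Renamings and substitutions

  variable
    Δ Δ₁ Δ₂ Δ₃ Γ Γ₁ Γ₂ Γ₃ : Ctx
    s t u : Type

  infix 4 _≐_

  _≐_ : Δ ⊆ Δ₁ → Δ ⊆ Δ₁ → Set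
  _≐_ {Δ} ρ ρ' = ∀ {s} (x : s ∈ Δ) → ρ x ≡ ρ' x

  _≐ˢ_ : Sub Δ Γ Γ₁ → Sub Δ Γ Γ₁ → Set
  _≐ˢ_ {Γ = Γ} σ σ' = ∀ {t} (x : t ∈ Γ) → σ x ≡ σ' x

  ∷⁺ʳ-∘ : {ρ : Δ ⊆ Δ₁} {ρ' : Δ₁ ⊆ Δ₂} {ρ'' : Δ ⊆ Δ₂} →
    ρ' ∘ ρ ≐ ρ'' → ∷⁺ʳ s ρ' ∘ ∷⁺ʳ s ρ ≐ ∷⁺ʳ s ρ''
  ∷⁺ʳ-∘ h (here p)  = refl
  ∷⁺ʳ-∘ h (there x) = cong there (h x)

  ∷⁺ʳ-id : {ρ : Δ ⊆ Δ} → ρ ≐ id → ∷⁺ʳ s ρ ≐ id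
  ∷⁺ʳ-id h (here p)  = refl
  ∷⁺ʳ-id h (there x) = cong there (h x)

  renᶜ-∘ : {ρ : Δ ⊆ Δ₁} {ρ' : Δ₁ ⊆ Δ₂} {ρ'' : Δ ⊆ Δ₂} →
    ρ' ∘ ρ ≐ ρ'' → (a : Chan Δ s) → renᶜ ρ' (renᶜ ρ a) ≡ renᶜ ρ'' a
  renᶜ-∘ h (free k)  = refl
  renᶜ-∘ h (bound x) = cong bound (h x)

  renᶜ-id : {ρ : Δ ⊆ Δ} → ρ ≐ id → (a : Chan Δ s) → renᶜ ρ a ≡ a
  renᶜ-id h (free k)  = refl
  renᶜ-id h (bound x) = cong bound (h x)

  cong₃ : ∀ {A B C D : Set} (f : A → B → C → D) {x x' y y' z z'} →
    x ≡ x' → y ≡ y' → z ≡ z' → f x y z ≡ f x' y' z'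
  cong₃ f refl refl refl = refl

  ren-∘ : {ρ : Δ ⊆ Δ₁} {ρ' : Δ₁ ⊆ Δ₂} {ρ'' : Δ ⊆ Δ₂} {ξ : Γ ⊆ Γ₁} {ξ' : Γ₁ ⊆ Γ₂} {ξ'' : Γ ⊆ Γ₂} →
    ρ' ∘ ρ ≐ ρ'' → ξ' ∘ ξ ≐ ξ'' → (T : Term Δ Γ t) → ren ρ' ξ' (ren ρ ξ T) ≡ ren ρ'' ξ'' T
  ren-∘ h k 𝟎           = refl
  ren-∘ h k (var x)     = cong var (k x)
  ren-∘ h k (inp a T)   = cong₂ inp (renᶜ-∘ h a) (ren-∘ h (∷⁺ʳ-∘ k) T)
  ren-∘ h k (out a O T) = cong₃ out (renᶜ-∘ h a) (ren-∘ h k O) (ren-∘ h k T)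
  ren-∘ h k (T ∥ U)     = cong₂ _∥_ (ren-∘ h k T) (ren-∘ h k U)
  ren-∘ h k (ν s T)     = cong (ν s) (ren-∘ (∷⁺ʳ-∘ h) k T)
  ren-∘ h k (lam e T)   = cong (lam e) (ren-∘ h (∷⁺ʳ-∘ k) T)
  ren-∘ h k (app e T U) = cong₂ (app e) (ren-∘ h k T) (ren-∘ h k U)

  ren-id : {ρ : Δ ⊆ Δ} {ξ : Γ ⊆ Γ} → ρ ≐ id → ξ ≐ id → (T : Term Δ Γ t) → ren ρ ξ T ≡ T
  ren-id h k 𝟎           = refl
  ren-id h k (var x)     = cong var (k x)
  ren-id h k (inp a T)   = cong₂ inp (renᶜ-id h a) (ren-id h (∷⁺ʳ-id k) T)
  ren-id h k (out a O T) = cong₃ out (renᶜ-id h a) (ren-id h k O) (ren-id h k T)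
  ren-id h k (T ∥ U)     = cong₂ _∥_ (ren-id h k T) (ren-id h k U)
  ren-id h k (ν s T)     = cong (ν s) (ren-id (∷⁺ʳ-id h) k T)
  ren-id h k (lam e T)   = cong (lam e) (ren-id h (∷⁺ʳ-id k) T)
  ren-id h k (app e T U) = cong₂ (app e) (ren-id h k T) (ren-id h k U)

  ren-ext : {ρ ρ' : Δ ⊆ Δ₁} {ξ ξ' : Γ ⊆ Γ₁} →
    ρ ≐ ρ' → ξ ≐ ξ' → (T : Term Δ Γ t) → ren ρ ξ T ≡ ren ρ' ξ' T
  ren-ext h k T =
    trans (cong (ren _ _) (sym (ren-id {ρ = id} {ξ = id} (λ _ → refl) (λ _ → refl) T))) (ren-∘ h k T)

  ren-square : {ρ₁ : Δ ⊆ Δ₁} {ρ₁' : Δ₁ ⊆ Δ₃} {ρ₂ : Δ ⊆ Δ₂} {ρ₂' : Δ₂ ⊆ Δ₃}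
    {ξ₁ : Γ ⊆ Γ₁} {ξ₁' : Γ₁ ⊆ Γ₃} {ξ₂ : Γ ⊆ Γ₂} {ξ₂' : Γ₂ ⊆ Γ₃} →
    ρ₁' ∘ ρ₁ ≐ ρ₂' ∘ ρ₂ → ξ₁' ∘ ξ₁ ≐ ξ₂' ∘ ξ₂ →
    (T : Term Δ Γ t) → ren ρ₁' ξ₁' (ren ρ₁ ξ₁ T) ≡ ren ρ₂' ξ₂' (ren ρ₂ ξ₂ T)
  ren-square h k T = trans (ren-∘ h k T) (sym (ren-∘ (λ _ → refl) (λ _ → refl) T))

  liftᵛ-square : ∀ {ρ : Δ ⊆ Δ₁} {ξ : Γ ⊆ Γ₁} {ξ' : Γ₂ ⊆ Γ₃} {σ : Sub Δ Γ Γ₂} {σ' : Sub Δ₁ Γ₁ Γ₃} →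
    (∀ {t} (x : t ∈ Γ) → σ' (ξ x) ≡ ren ρ ξ' (σ x)) →
    ∀ {t} (x : t ∈ s ∷ Γ) → liftᵛ σ' (∷⁺ʳ s ξ x) ≡ ren ρ (∷⁺ʳ s ξ') (liftᵛ σ x)
  liftᵛ-square h (here p)  = refl
  liftᵛ-square {σ = σ} h (there x) = trans (cong (ren id there) (h x)) (ren-square (λ _ → refl) (λ _ → refl) (σ x))

  liftᶜ-square : ∀ {ρ : Δ ⊆ Δ₁} {ξ : Γ ⊆ Γ₁} {ξ' : Γ₂ ⊆ Γ₃} {σ : Sub Δ Γ Γ₂} {σ' : Sub Δ₁ Γ₁ Γ₃} →
    (∀ {t} (x : t ∈ Γ) → σ' (ξ x) ≡ ren ρ ξ' (σ x)) →
    ∀ {t} (x : t ∈ Γ) → liftᶜ {s = s} σ' (ξ x) ≡ ren (∷⁺ʳ s ρ) ξ' (liftᶜ σ x)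
  liftᶜ-square {σ = σ} h x = trans (cong (ren there id) (h x)) (ren-square (λ _ → refl) (λ _ → refl) (σ x))

  sub-ren : ∀ {ρ : Δ ⊆ Δ₁} {ξ : Γ ⊆ Γ₁} {ξ' : Γ₂ ⊆ Γ₃} {σ : Sub Δ Γ Γ₂} {σ' : Sub Δ₁ Γ₁ Γ₃} →
    (∀ {t} (x : t ∈ Γ) → σ' (ξ x) ≡ ren ρ ξ' (σ x)) →
    (T : Term Δ Γ t) → sub σ' (ren ρ ξ T) ≡ ren ρ ξ' (sub σ T)
  sub-ren h 𝟎           = refl
  sub-ren h (var x)     = h x
  sub-ren h (inp a T)   = cong (inp _) (sub-ren (liftᵛ-square h) T)
  sub-ren h (out a O T) = cong₂ (out _) (sub-ren h O) (sub-ren h T)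
  sub-ren h (T ∥ U)     = cong₂ _∥_ (sub-ren h T) (sub-ren h U)
  sub-ren {ξ = ξ} {σ' = σ'} h (ν s T) = cong (ν s) (sub-ren (liftᶜ-square {ξ = ξ} {σ' = σ'} h) T)
  sub-ren h (lam e T)   = cong (lam e) (sub-ren (liftᵛ-square h) T)
  sub-ren h (app e T U) = cong₂ (app e) (sub-ren h T) (sub-ren h U)

  sub-∘ : {σ : Sub Δ Γ Γ₁} {σ' : Sub Δ Γ₁ Γ₂} {σ'' : Sub Δ Γ Γ₂} →
    (sub σ' ∘ σ) ≐ˢ σ'' → (T : Term Δ Γ t) → sub σ' (sub σ T) ≡ sub σ'' T
  liftᵛ-∘ : {σ : Sub Δ Γ Γ₁} {σ' : Sub Δ Γ₁ Γ₂} {σ'' : Sub Δ Γ Γ₂} →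
    (sub σ' ∘ σ) ≐ˢ σ'' → (sub (liftᵛ {s = s} σ') ∘ liftᵛ σ) ≐ˢ liftᵛ σ''
  liftᵛ-∘ h (here p)  = refl
  liftᵛ-∘ {σ = σ} h (there x) = trans (sub-ren (λ _ → refl) (σ x)) (cong (ren id there) (h x))
  liftᶜ-∘ : {σ : Sub Δ Γ Γ₁} {σ' : Sub Δ Γ₁ Γ₂} {σ'' : Sub Δ Γ Γ₂} →
    (sub σ' ∘ σ) ≐ˢ σ'' → (sub (liftᶜ {s = s} σ') ∘ liftᶜ σ) ≐ˢ liftᶜ σ''
  liftᶜ-∘ {σ = σ} h x = trans (sub-ren (λ _ → refl) (σ x)) (cong (ren there id) (h x))

  sub-∘ h 𝟎           = refl
  sub-∘ h (var x)     = h x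
  sub-∘ h (inp a T)   = cong (inp a) (sub-∘ (liftᵛ-∘ h) T)
  sub-∘ h (out a O T) = cong₂ (out a) (sub-∘ h O) (sub-∘ h T)
  sub-∘ h (T ∥ U)     = cong₂ _∥_ (sub-∘ h T) (sub-∘ h U)
  sub-∘ {σ = σ} {σ' = σ'} h (ν s T) = cong (ν s) (sub-∘ (liftᶜ-∘ {σ = σ} {σ' = σ'} h) T)
  sub-∘ h (lam e T)   = cong (lam e) (sub-∘ (liftᵛ-∘ h) T)
  sub-∘ h (app e T U) = cong₂ (app e) (sub-∘ h T) (sub-∘ h U)

  liftᵛ-var : {σ : Sub Δ Γ Γ} → σ ≐ˢ var → liftᵛ {s = s} σ ≐ˢ var
  liftᵛ-var h (here p)  = refl
  liftᵛ-var h (there x) = cong (ren id there) (h x)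

  sub-var : {σ : Sub Δ Γ Γ} → σ ≐ˢ var → (T : Term Δ Γ t) → sub σ T ≡ T
  sub-var h 𝟎           = refl
  sub-var h (var x)     = h x
  sub-var h (inp a T)   = cong (inp a) (sub-var (liftᵛ-var h) T)
  sub-var h (out a O T) = cong₂ (out a) (sub-var h O) (sub-var h T)
  sub-var h (T ∥ U)     = cong₂ _∥_ (sub-var h T) (sub-var h U)
  sub-var h (ν s T)     = cong (ν s) (sub-var (λ x → cong (ren there id) (h x)) T)
  sub-var h (lam e T)   = cong (lam e) (sub-var (liftᵛ-var h) T)
  sub-var h (app e T U) = cong₂ (app e) (sub-var h T) (sub-var h U)

  sub-ext : {σ σ' : Sub Δ Γ Γ₁} → σ ≐ˢ σ' → (T : Term Δ Γ t) → sub σ T ≡ sub σ' T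
  sub-ext {σ = σ} h T = trans (cong (sub σ) (sym (sub-var {σ = var} (λ _ → refl) T))) (sub-∘ h T)

  sub-ren-cancel : {ξ : Γ ⊆ Γ₁} {σ : Sub Δ Γ₁ Γ} → (σ ∘ ξ) ≐ˢ var →
    (T : Term Δ Γ t) → sub σ (ren id ξ T) ≡ T
  sub-ren-cancel h T =
    trans (sub-ren {ξ' = id} {σ = var} h T)
      (trans (ren-id (λ _ → refl) (λ _ → refl) _) (sub-var (λ _ → refl) T))

  there-[] : (T : Term Δ Γ t) {U : Term Δ Γ s} → ren id there T [ U ] ≡ T
  there-[] T = sub-ren-cancel (λ _ → refl) T

  ren-[] : (ρ : Δ ⊆ Δ₁) (ξ : Γ ⊆ Γ₁) (T : Term Δ (s ∷ Γ) t) {U : Term Δ Γ s} →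
    ren ρ (∷⁺ʳ s ξ) T [ ren ρ ξ U ] ≡ ren ρ ξ (T [ U ])
  ren-[] ρ ξ T = sub-ren (λ { (here refl) → refl ; (there x) → refl }) T

  renᶜ-[] : (ρ : Δ ⊆ Δ₁) (T : Term Δ (s ∷ Γ) t) {U : Term Δ Γ s} →
    ren ρ id T [ ren ρ id U ] ≡ ren ρ id (T [ U ])
  renᶜ-[] ρ T = sub-ren (λ { (here refl) → refl ; (there x) → refl }) T

  sub-single : (σ : Sub Δ Γ Γ₁) (T : Term Δ (s ∷ Γ) t) {U : Term Δ Γ s} →
    sub (liftᵛ σ) T [ sub σ U ] ≡ sub σ (T [ U ])
  sub-single σ T {U} = trans (sub-∘ h T) (sym (sub-∘ (λ _ → refl) T))
    where
    h : (sub (single (sub σ U)) ∘ liftᵛ σ) ≐ˢ (sub σ ∘ single U)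
    h (here refl) = refl
    h (there x)   = there-[] (σ x)

  ν-[] : (T : Term (u ∷ Δ) (s ∷ Γ) ◇) {U : Term Δ Γ s} →
    ν u T [ U ] ≡ ν u (T [ ren there id U ])
  ν-[] T = cong (ν _) (sub-ext (λ { (here refl) → refl ; (there x) → refl }) T)

  -- Head reduction

  infix 4 _⟶_ _⟶*_

  -- Contraction is allowed only on the way to an active prefix: never below a prefix or an
  -- abstraction, nor in an argument. `head-β` keeps its contractum behind an equation, so that
  -- matching on a step need not unify an index with a substitution.
  data _⟶_ {Δ Γ : Ctx} : Term Δ Γ t → Term Δ Γ t → Set where
    head-β : ∀ {α} {e : cod α ≡ t} {T U V} → V ≡ T [ U ] → app e (lam e T) U ⟶ V
    appˡ   : ∀ {α} {e : cod α ≡ t} {T T' U} → T ⟶ T' → app e T U ⟶ app e T' U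
    ∥ˡ     : ∀ {T T' U} → T ⟶ T' → T ∥ U ⟶ T' ∥ U
    ∥ʳ     : ∀ {T U U'} → U ⟶ U' → T ∥ U ⟶ T ∥ U'
    under-ν : ∀ {T T'} → T ⟶ T' → ν s T ⟶ ν s T'

  _⟶*_ : Term Δ Γ t → Term Δ Γ t → Set
  _⟶*_ = Star _⟶_

  ⟶-ren : (ρ : Δ ⊆ Δ₁) (ξ : Γ ⊆ Γ₁) {T U : Term Δ Γ t} → T ⟶ U → ren ρ ξ T ⟶ ren ρ ξ U
  ⟶-ren ρ ξ (head-β {T = T} refl) = head-β (sym (ren-[] ρ ξ T))
  ⟶-ren ρ ξ (appˡ r)    = appˡ (⟶-ren ρ ξ r)
  ⟶-ren ρ ξ (∥ˡ r)      = ∥ˡ (⟶-ren ρ ξ r)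
  ⟶-ren ρ ξ (∥ʳ r)      = ∥ʳ (⟶-ren ρ ξ r)
  ⟶-ren ρ ξ (under-ν r) = under-ν (⟶-ren (∷⁺ʳ _ ρ) ξ r)

  ⟶-sub : (σ : Sub Δ Γ Γ₁) {T U : Term Δ Γ t} → T ⟶ U → sub σ T ⟶ sub σ U
  ⟶-sub σ (head-β {T = T} refl) = head-β (sym (sub-single σ T))
  ⟶-sub σ (appˡ r)    = appˡ (⟶-sub σ r)
  ⟶-sub σ (∥ˡ r)      = ∥ˡ (⟶-sub σ r)
  ⟶-sub σ (∥ʳ r)      = ∥ʳ (⟶-sub σ r)
  ⟶-sub σ (under-ν r) = under-ν (⟶-sub (liftᶜ σ) r)

  -- Renaming variables to variables creates no redex, so steps can be pulled back. This serves
  -- scope extrusion and `COM`, where a component occurs weakened.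
  ⟶-ren⁻¹ : (ρ : Δ ⊆ Δ₁) (ξ : Γ ⊆ Γ₁) (T : Term Δ Γ t) {X : Term Δ₁ Γ₁ t} →
    ren ρ ξ T ⟶ X → ∃ λ T' → T ⟶ T' × X ≡ ren ρ ξ T'
  ⟶-ren⁻¹ ρ ξ (T ∥ U) (∥ˡ r) with ⟶-ren⁻¹ ρ ξ T r
  ... | _ , r' , refl = _ , ∥ˡ r' , refl
  ⟶-ren⁻¹ ρ ξ (T ∥ U) (∥ʳ r) with ⟶-ren⁻¹ ρ ξ U r
  ... | _ , r' , refl = _ , ∥ʳ r' , refl
  ⟶-ren⁻¹ ρ ξ (ν s T) (under-ν r) with ⟶-ren⁻¹ (∷⁺ʳ s ρ) ξ T r
  ... | _ , r' , refl = _ , under-ν r' , refl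
  ⟶-ren⁻¹ ρ ξ (app e (lam e' T) U) (head-β refl) = _ , head-β refl , ren-[] ρ ξ T
  ⟶-ren⁻¹ ρ ξ (app e T U) (appˡ r) with ⟶-ren⁻¹ ρ ξ T r
  ... | _ , r' , refl = _ , appˡ r' , refl

  ⟶*-ren⁻¹ : (ρ : Δ ⊆ Δ₁) (ξ : Γ ⊆ Γ₁) (T : Term Δ Γ t) {X : Term Δ₁ Γ₁ t} →
    ren ρ ξ T ⟶* X → ∃ λ T' → T ⟶* T' × X ≡ ren ρ ξ T'
  ⟶*-ren⁻¹ ρ ξ T ε = T , ε , refl
  ⟶*-ren⁻¹ ρ ξ T (r ◅ rs) with ⟶-ren⁻¹ ρ ξ T r
  ... | T₁ , r' , refl with ⟶*-ren⁻¹ ρ ξ T₁ rs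
  ...   | T₂ , rs' , eq = T₂ , r' ◅ rs' , eq

  -- Commitments

  data Kind : Set where
    rcv snd : Type → Kind
    tau     : Kind

  Subj : Ctx → Kind → Set
  Subj Δ (rcv s) = Chan Δ s
  Subj Δ (snd s) = Chan Δ s
  Subj Δ tau     = ⊤

  renˢ : Δ ⊆ Δ₁ → ∀ k → Subj Δ k → Subj Δ₁ k
  renˢ ρ (rcv s) a = renᶜ ρ a
  renˢ ρ (snd s) a = renᶜ ρ a
  renˢ ρ tau     a = tt

  -- An input stays open in the variable it will receive, so that its result can be passed as the
  -- receiver of an output.
  Ext : Kind → Ctx → Ctx
  Ext (rcv s) Γ = s ∷ Γ
  Ext (snd s) Γ = Γ
  Ext tau     Γ = Γ

  Ext-⊆ : ∀ k → Γ ⊆ Γ₁ → Ext k Γ ⊆ Ext k Γ₁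
  Ext-⊆ (rcv s) ξ = ∷⁺ʳ s ξ
  Ext-⊆ (snd s) ξ = ξ
  Ext-⊆ tau     ξ = ξ

  Arg : Kind → Ctx → Ctx → Set
  Arg (rcv s) Δ Γ = ⊤
  Arg (snd s) Δ Γ = Term Δ (s ∷ Γ) ◇
  Arg tau     Δ Γ = ⊤

  renᵃ : Δ ⊆ Δ₁ → Γ ⊆ Γ₁ → ∀ k → Arg k Δ Γ → Arg k Δ₁ Γ₁
  renᵃ ρ ξ (rcv s) x = tt
  renᵃ ρ ξ (snd s) F = ren ρ (∷⁺ʳ s ξ) F
  renᵃ ρ ξ tau     x = tt

  wk : ∀ k → Term Δ Γ ◇ → Term Δ (Ext k Γ) ◇
  wk (rcv s) T = ren id there T
  wk (snd s) T = T
  wk tau     T = T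

  wk-ren : (ρ : Δ ⊆ Δ₁) (ξ : Γ ⊆ Γ₁) → ∀ k (T : Term Δ Γ ◇) →
    wk k (ren ρ ξ T) ≡ ren ρ (Ext-⊆ k ξ) (wk k T)
  wk-ren ρ ξ (rcv s) T = ren-square (λ _ → refl) (λ _ → refl) T
  wk-ren ρ ξ (snd s) T = refl
  wk-ren ρ ξ tau     T = refl

  renˢ-square : {ρ₁ : Δ ⊆ Δ₁} {ρ₁' : Δ₁ ⊆ Δ₃} {ρ₂ : Δ ⊆ Δ₂} {ρ₂' : Δ₂ ⊆ Δ₃} →
    ρ₁' ∘ ρ₁ ≐ ρ₂' ∘ ρ₂ → ∀ k (a : Subj Δ k) → renˢ ρ₁' k (renˢ ρ₁ k a) ≡ renˢ ρ₂' k (renˢ ρ₂ k a)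
  renˢ-square h (rcv s) a = trans (renᶜ-∘ h a) (sym (renᶜ-∘ (λ _ → refl) a))
  renˢ-square h (snd s) a = trans (renᶜ-∘ h a) (sym (renᶜ-∘ (λ _ → refl) a))
  renˢ-square h tau     a = refl

  renᵃ-square : {ρ₁ : Δ ⊆ Δ₁} {ρ₁' : Δ₁ ⊆ Δ₃} {ρ₂ : Δ ⊆ Δ₂} {ρ₂' : Δ₂ ⊆ Δ₃}
    {ξ₁ : Γ ⊆ Γ₁} {ξ₁' : Γ₁ ⊆ Γ₃} {ξ₂ : Γ ⊆ Γ₂} {ξ₂' : Γ₂ ⊆ Γ₃} →
    ρ₁' ∘ ρ₁ ≐ ρ₂' ∘ ρ₂ → ξ₁' ∘ ξ₁ ≐ ξ₂' ∘ ξ₂ →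
    ∀ k (x : Arg k Δ Γ) → renᵃ ρ₁' ξ₁' k (renᵃ ρ₁ ξ₁ k x) ≡ renᵃ ρ₂' ξ₂' k (renᵃ ρ₂ ξ₂ k x)
  renᵃ-square h l (rcv s) x = refl
  renᵃ-square {ξ₁ = ξ₁} {ξ₁'} {ξ₂} {ξ₂'} h l (snd s) F = ren-square h l' F
    where
    l' : ∷⁺ʳ s ξ₁' ∘ ∷⁺ʳ s ξ₁ ≐ ∷⁺ʳ s ξ₂' ∘ ∷⁺ʳ s ξ₂
    l' (here p)  = refl
    l' (there x) = cong there (l x)
  renᵃ-square h l tau     x = refl

  infix 4 _↓_∙_

  -- T ↓ k ∙ a: an active prefix (or, for k = tau, a pair of matching active
  -- prefixes) of T.
  data _↓_∙_ {Δ Γ : Ctx} : Term Δ Γ ◇ → (k : Kind) → Subj Δ k → Set where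
    inp  : ∀ {a : Chan Δ s} {T} → inp a T ↓ rcv s ∙ a
    out  : ∀ {a : Chan Δ s} {O T} → out a O T ↓ snd s ∙ a
    parˡ : ∀ {k a T U} → T ↓ k ∙ a → T ∥ U ↓ k ∙ a
    parʳ : ∀ {k a T U} → U ↓ k ∙ a → T ∥ U ↓ k ∙ a
    res  : ∀ {k a b T} → renˢ there k a ≡ b → T ↓ k ∙ b → ν s T ↓ k ∙ a
    comˡ : ∀ {a T U} → T ↓ rcv s ∙ a → U ↓ snd s ∙ a → T ∥ U ↓ tau ∙ tt
    comʳ : ∀ {a T U} → T ↓ snd s ∙ a → U ↓ rcv s ∙ a → T ∥ U ↓ tau ∙ tt

  -- An output is described by what becomes of the term when its object is
  -- received by an abstraction F: this hides extruded names, so no scope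
  -- bookkeeping is needed.
  result : ∀ {T : Term Δ Γ ◇} {k a} → T ↓ k ∙ a → Arg k Δ Γ → Term Δ (Ext k Γ) ◇
  result (inp {T = T})          x = T
  result (out {O = O} {T = T})  F = F [ O ] ∥ T
  result (parˡ {k} {U = U} d)   x = result d x ∥ wk k U
  result (parʳ {k} {T = T} d)   x = wk k T ∥ result d x
  result (res {s} {k} _ d)      x = ν s (result d (renᵃ there id k x))
  result (comˡ c d)             x = result d (result c tt)
  result (comʳ d c)             x = result d (result c tt)

  renᵈ : (ρ : Δ ⊆ Δ₁) (ξ : Γ ⊆ Γ₁) {T : Term Δ Γ ◇} → ∀ {k a} →
    T ↓ k ∙ a → ren ρ ξ T ↓ k ∙ renˢ ρ k a
  renᵈ ρ ξ inp        = inp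
  renᵈ ρ ξ out        = out
  renᵈ ρ ξ (parˡ d)   = parˡ (renᵈ ρ ξ d)
  renᵈ ρ ξ (parʳ d)   = parʳ (renᵈ ρ ξ d)
  renᵈ ρ ξ (res {k = k} {a} eq d) =
    res (trans (renˢ-square (λ _ → refl) k a) (cong (renˢ _ k) eq)) (renᵈ (∷⁺ʳ _ ρ) ξ d)
  renᵈ ρ ξ (comˡ c d) = comˡ (renᵈ ρ ξ c) (renᵈ ρ ξ d)
  renᵈ ρ ξ (comʳ d c) = comʳ (renᵈ ρ ξ d) (renᵈ ρ ξ c)

  result-renᵈ : (ρ : Δ ⊆ Δ₁) (ξ : Γ ⊆ Γ₁) {T : Term Δ Γ ◇} → ∀ {k a} (d : T ↓ k ∙ a) x →
    result (renᵈ ρ ξ d) (renᵃ ρ ξ k x) ≡ ren ρ (Ext-⊆ k ξ) (result d x)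
  result-renᵈ ρ ξ inp x = refl
  result-renᵈ ρ ξ out F = cong (_∥ _) (ren-[] ρ ξ F)
  result-renᵈ ρ ξ (parˡ {k} {U = U} d) x = cong₂ _∥_ (result-renᵈ ρ ξ d x) (wk-ren ρ ξ k U)
  result-renᵈ ρ ξ (parʳ {k} {T = T} d) x = cong₂ _∥_ (wk-ren ρ ξ k T) (result-renᵈ ρ ξ d x)
  result-renᵈ ρ ξ (res {k = k} refl d) x =
    cong (ν _) (trans (cong (result (renᵈ (∷⁺ʳ _ ρ) ξ d)) (renᵃ-square (λ _ → refl) (λ _ → refl) k x))
                      (result-renᵈ (∷⁺ʳ _ ρ) ξ d (renᵃ there id k x)))
  result-renᵈ ρ ξ (comˡ c d) x =
    trans (cong (result (renᵈ ρ ξ d)) (result-renᵈ ρ ξ c tt)) (result-renᵈ ρ ξ d (result c tt))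
  result-renᵈ ρ ξ (comʳ d c) x =
    trans (cong (result (renᵈ ρ ξ d)) (result-renᵈ ρ ξ c tt)) (result-renᵈ ρ ξ d (result c tt))

  Inj : Δ ⊆ Δ₁ → Set
  Inj {Δ} ρ = ∀ {s} {x y : s ∈ Δ} → ρ x ≡ ρ y → x ≡ y

  there-injective : {x y : s ∈ Δ} → _≡_ {A = s ∈ (t ∷ Δ)} (there x) (there y) → x ≡ y
  there-injective refl = refl

  there-inj : Inj (there {x = s} {xs = Δ})
  there-inj = there-injective

  ∷⁺ʳ-inj : {ρ : Δ ⊆ Δ₁} → Inj ρ → Inj (∷⁺ʳ s ρ)
  ∷⁺ʳ-inj i {x = here refl} {here refl} eq = refl
  ∷⁺ʳ-inj i {x = there x} {there y}     eq = cong there (i (there-injective eq))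

  bound-injective : {x y : s ∈ Δ} → bound x ≡ bound y → x ≡ y
  bound-injective refl = refl

  renᶜ-inj : {ρ : Δ ⊆ Δ₁} → Inj ρ → (a b : Chan Δ s) → renᶜ ρ a ≡ renᶜ ρ b → a ≡ b
  renᶜ-inj i (free k)  (free .k)  refl = refl
  renᶜ-inj i (bound x) (bound y) eq   = cong bound (i (bound-injective eq))

  -- The newest channel lies outside the image of `there`, so `c` must itself be a weakening. This
  -- lets a commitment that was pulled back below a restriction leave that restriction.
  renᶜ-pullback : (ρ : Δ ⊆ Δ₁) (b : Chan Δ₁ s) (c : Chan (t ∷ Δ) s) →
    renᶜ there b ≡ renᶜ (∷⁺ʳ t ρ) c → ∃ λ a → renᶜ there a ≡ c × renᶜ ρ a ≡ b
  renᶜ-pullback ρ (free k)  (free .k)         refl = free k , refl , refl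
  renᶜ-pullback ρ (bound y) (bound (there x)) eq   =
    bound x , refl , cong bound (sym (there-injective (bound-injective eq)))

  renˢ-pullback : (ρ : Δ ⊆ Δ₁) → ∀ k (b : Subj Δ₁ k) (c : Subj (t ∷ Δ) k) →
    renˢ there k b ≡ renˢ (∷⁺ʳ t ρ) k c → ∃ λ a → renˢ there k a ≡ c × renˢ ρ k a ≡ b
  renˢ-pullback ρ (rcv s) b c eq = renᶜ-pullback ρ b c eq
  renˢ-pullback ρ (snd s) b c eq = renᶜ-pullback ρ b c eq
  renˢ-pullback ρ tau     b c eq = tt , refl , refl

  -- Injectivity excludes new communications, which would arise if `ρ` identified the subjects of an
  -- input and an output. The given derivation is recovered and not merely some derivation, since
  -- `result` depends on it.
  renᵈ⁻¹ : (ρ : Δ ⊆ Δ₁) (ξ : Γ ⊆ Γ₁) → Inj ρ → (T : Term Δ Γ ◇) → ∀ {k b} (d : ren ρ ξ T ↓ k ∙ b) →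
    ∃ λ a → Σ (T ↓ k ∙ a) λ d₀ → Σ (renˢ ρ k a ≡ b) λ eq →
      subst (ren ρ ξ T ↓ k ∙_) eq (renᵈ ρ ξ d₀) ≡ d
  renᵈ⁻¹ ρ ξ i (inp a T)   inp = a , inp , refl , refl
  renᵈ⁻¹ ρ ξ i (out a O T) out = a , out , refl , refl
  renᵈ⁻¹ ρ ξ i (T ∥ U) (parˡ d) with renᵈ⁻¹ ρ ξ i T d
  ... | a , d₀ , refl , refl = a , parˡ d₀ , refl , refl
  renᵈ⁻¹ ρ ξ i (T ∥ U) (parʳ d) with renᵈ⁻¹ ρ ξ i U d
  ... | a , d₀ , refl , refl = a , parʳ d₀ , refl , refl
  renᵈ⁻¹ ρ ξ i (T ∥ U) (comˡ c d) with renᵈ⁻¹ ρ ξ i T c | renᵈ⁻¹ ρ ξ i U d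
  ... | a , c₀ , refl , refl | b , d₀ , eq , refl with renᶜ-inj i b a eq
  ...   | refl with uip eq refl
  ...     | refl = tt , comˡ c₀ d₀ , refl , refl
  renᵈ⁻¹ ρ ξ i (T ∥ U) (comʳ d c) with renᵈ⁻¹ ρ ξ i U c | renᵈ⁻¹ ρ ξ i T d
  ... | a , c₀ , refl , refl | b , d₀ , eq , refl with renᶜ-inj i b a eq
  ...   | refl with uip eq refl
  ...     | refl = tt , comʳ d₀ c₀ , refl , refl
  renᵈ⁻¹ ρ ξ i (ν s T) (res {k = k} {b} eq d) with renᵈ⁻¹ (∷⁺ʳ s ρ) ξ (∷⁺ʳ-inj i) T d
  ... | c , d₀ , refl , refl with renˢ-pullback ρ k b c eq
  ...   | a , refl , refl = a , res refl d₀ , refl , cong (λ p → res p _) (uip _ _)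

  -- Structural congruence with β oriented from left to right

  -- The mode `exact` leaves out `⊳-β`, the one law without an inverse here, and is therefore
  -- symmetric; laws available in every mode can be reversed and still be used together with
  -- contraction.
  data Mode : Set where
    exact reducing : Mode

  infix 4 _⊳[_]_

  data _⊳[_]_ {Δ Γ : Ctx} : Term Δ Γ t → Mode → Term Δ Γ t → Set where
    ⊳-refl  : ∀ {f} {T : Term Δ Γ t} → T ⊳[ f ] T
    ⊳-trans : ∀ {f} {T U V : Term Δ Γ t} → T ⊳[ f ] U → U ⊳[ f ] V → T ⊳[ f ] V

    ⊳-inp : ∀ {f} {a : Chan Δ s} {T T'} → T ⊳[ f ] T' → inp a T ⊳[ f ] inp a T'
    ⊳-out : ∀ {f} {a : Chan Δ s} {O O' T T'} → O ⊳[ f ] O' → T ⊳[ f ] T' → out a O T ⊳[ f ] out a O' T'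
    ⊳-par : ∀ {f T T' U U'} → T ⊳[ f ] T' → U ⊳[ f ] U' → T ∥ U ⊳[ f ] T' ∥ U'
    ⊳-ν   : ∀ {f T T'} → T ⊳[ f ] T' → ν s T ⊳[ f ] ν s T'
    ⊳-lam : ∀ {f α} {e : cod α ≡ t} {T T'} → T ⊳[ f ] T' → lam e T ⊳[ f ] lam e T'
    ⊳-app : ∀ {f α} {e : cod α ≡ t} {T T' U U'} → T ⊳[ f ] T' → U ⊳[ f ] U' → app e T U ⊳[ f ] app e T' U'

    ⊳-assoc  : ∀ {f T U V} → (T ∥ U) ∥ V ⊳[ f ] T ∥ (U ∥ V)
    ⊳-comm   : ∀ {f T U} → T ∥ U ⊳[ f ] U ∥ T
    ⊳-unit   : ∀ {f T} → T ∥ 𝟎 ⊳[ f ] T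
    ⊳-unit⁻¹ : ∀ {f T} → T ⊳[ f ] T ∥ 𝟎

    ⊳-swap      : ∀ {f T T'} → T' ≡ ren swap id T → ν s (ν t T) ⊳[ f ] ν t (ν s T')
    ⊳-νinp      : ∀ {f T} → ν s (inp newest T) ⊳[ f ] 𝟎
    ⊳-νinp⁻¹    : ∀ {f T} → 𝟎 ⊳[ f ] ν s (inp newest T)
    ⊳-νout      : ∀ {f O T} → ν s (out newest O T) ⊳[ f ] 𝟎
    ⊳-νout⁻¹    : ∀ {f O T} → 𝟎 ⊳[ f ] ν s (out newest O T)
    ⊳-extrude   : ∀ {f T U U'} → U' ≡ ren there id U → ν s (T ∥ U') ⊳[ f ] ν s T ∥ U
    ⊳-extrude⁻¹ : ∀ {f T U U'} → U' ≡ ren there id U → ν s T ∥ U ⊳[ f ] ν s (T ∥ U')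
    ⊳-β         : ∀ {α} {e : cod α ≡ t} {T U V} → V ≡ T [ U ] → app e (lam e T) U ⊳[ reducing ] V

  ⊳-≡ : ∀ {f} {T U : Term Δ Γ t} → T ≡ U → T ⊳[ f ] U
  ⊳-≡ refl = ⊳-refl

  ⊳⇒≣ : ∀ {f} {T U : Term Δ Γ t} → T ⊳[ f ] U → T ≣ U
  ⊳⇒≣ ⊳-refl             = ≣-refl
  ⊳⇒≣ (⊳-trans p q)      = ≣-trans (⊳⇒≣ p) (⊳⇒≣ q)
  ⊳⇒≣ (⊳-inp p)          = inp-cong (⊳⇒≣ p)
  ⊳⇒≣ (⊳-out p q)        = out-cong (⊳⇒≣ p) (⊳⇒≣ q)
  ⊳⇒≣ (⊳-par p q)        = ∥-cong (⊳⇒≣ p) (⊳⇒≣ q)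
  ⊳⇒≣ (⊳-ν p)            = ν-cong (⊳⇒≣ p)
  ⊳⇒≣ (⊳-lam p)          = lam-cong (⊳⇒≣ p)
  ⊳⇒≣ (⊳-app p q)        = app-cong (⊳⇒≣ p) (⊳⇒≣ q)
  ⊳⇒≣ ⊳-assoc            = ∥-assoc
  ⊳⇒≣ ⊳-comm             = ∥-comm
  ⊳⇒≣ ⊳-unit             = ∥-identity
  ⊳⇒≣ ⊳-unit⁻¹           = ≣-sym ∥-identity
  ⊳⇒≣ (⊳-swap refl)      = ν-swap
  ⊳⇒≣ ⊳-νinp             = ν-inp
  ⊳⇒≣ ⊳-νinp⁻¹           = ≣-sym ν-inp
  ⊳⇒≣ ⊳-νout             = ν-out
  ⊳⇒≣ ⊳-νout⁻¹           = ≣-sym ν-out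
  ⊳⇒≣ (⊳-extrude refl)   = ν-extrude
  ⊳⇒≣ (⊳-extrude⁻¹ refl) = ≣-sym ν-extrude
  ⊳⇒≣ (⊳-β refl)         = β

  ⊳-assoc⁻¹ : ∀ {f} {T U V : Term Δ Γ ◇} → T ∥ (U ∥ V) ⊳[ f ] (T ∥ U) ∥ V
  ⊳-assoc⁻¹ = ⊳-trans ⊳-comm (⊳-trans (⊳-par ⊳-comm ⊳-refl) (⊳-trans ⊳-assoc
                (⊳-trans ⊳-comm (⊳-par ⊳-comm ⊳-refl))))

  swap-swap : (x : s ∈ t ∷ u ∷ Δ) → swap (swap x) ≡ x
  swap-swap (here p)          = refl
  swap-swap (there (here p))  = refl
  swap-swap (there (there x)) = refl

  ⊳-sym : ∀ {f} {T U : Term Δ Γ t} → T ⊳[ exact ] U → U ⊳[ f ] T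
  ⊳-sym ⊳-refl          = ⊳-refl
  ⊳-sym (⊳-trans p q)   = ⊳-trans (⊳-sym q) (⊳-sym p)
  ⊳-sym (⊳-inp p)       = ⊳-inp (⊳-sym p)
  ⊳-sym (⊳-out p q)     = ⊳-out (⊳-sym p) (⊳-sym q)
  ⊳-sym (⊳-par p q)     = ⊳-par (⊳-sym p) (⊳-sym q)
  ⊳-sym (⊳-ν p)         = ⊳-ν (⊳-sym p)
  ⊳-sym (⊳-lam p)       = ⊳-lam (⊳-sym p)
  ⊳-sym (⊳-app p q)     = ⊳-app (⊳-sym p) (⊳-sym q)
  ⊳-sym ⊳-assoc         = ⊳-assoc⁻¹
  ⊳-sym ⊳-comm          = ⊳-comm
  ⊳-sym ⊳-unit          = ⊳-unit⁻¹
  ⊳-sym ⊳-unit⁻¹        = ⊳-unit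
  ⊳-sym (⊳-swap {T = T} refl) =
    ⊳-swap (sym (trans (ren-∘ swap-swap (λ _ → refl) T) (ren-id (λ _ → refl) (λ _ → refl) T)))
  ⊳-sym ⊳-νinp          = ⊳-νinp⁻¹
  ⊳-sym ⊳-νinp⁻¹        = ⊳-νinp
  ⊳-sym ⊳-νout          = ⊳-νout⁻¹
  ⊳-sym ⊳-νout⁻¹        = ⊳-νout
  ⊳-sym (⊳-extrude eq)   = ⊳-extrude⁻¹ eq
  ⊳-sym (⊳-extrude⁻¹ eq) = ⊳-extrude eq

  swap-lift : (ρ : Δ ⊆ Δ₁) (x : u ∈ s ∷ t ∷ Δ) →
    ∷⁺ʳ t (∷⁺ʳ s ρ) (swap x) ≡ swap (∷⁺ʳ s (∷⁺ʳ t ρ) x)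
  swap-lift ρ (here p)          = refl
  swap-lift ρ (there (here p))  = refl
  swap-lift ρ (there (there x)) = refl

  ⊳-ren : ∀ {f} (ρ : Δ ⊆ Δ₁) (ξ : Γ ⊆ Γ₁) {T U : Term Δ Γ t} → T ⊳[ f ] U → ren ρ ξ T ⊳[ f ] ren ρ ξ U
  ⊳-ren ρ ξ ⊳-refl          = ⊳-refl
  ⊳-ren ρ ξ (⊳-trans p q)   = ⊳-trans (⊳-ren ρ ξ p) (⊳-ren ρ ξ q)
  ⊳-ren ρ ξ (⊳-inp p)       = ⊳-inp (⊳-ren ρ (∷⁺ʳ _ ξ) p)
  ⊳-ren ρ ξ (⊳-out p q)     = ⊳-out (⊳-ren ρ ξ p) (⊳-ren ρ ξ q)
  ⊳-ren ρ ξ (⊳-par p q)     = ⊳-par (⊳-ren ρ ξ p) (⊳-ren ρ ξ q)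
  ⊳-ren ρ ξ (⊳-ν p)         = ⊳-ν (⊳-ren (∷⁺ʳ _ ρ) ξ p)
  ⊳-ren ρ ξ (⊳-lam p)       = ⊳-lam (⊳-ren ρ (∷⁺ʳ _ ξ) p)
  ⊳-ren ρ ξ (⊳-app p q)     = ⊳-app (⊳-ren ρ ξ p) (⊳-ren ρ ξ q)
  ⊳-ren ρ ξ ⊳-assoc         = ⊳-assoc
  ⊳-ren ρ ξ ⊳-comm          = ⊳-comm
  ⊳-ren ρ ξ ⊳-unit          = ⊳-unit
  ⊳-ren ρ ξ ⊳-unit⁻¹        = ⊳-unit⁻¹
  ⊳-ren ρ ξ (⊳-swap {T = T} refl) = ⊳-swap (ren-square (swap-lift ρ) (λ _ → refl) T)
  ⊳-ren ρ ξ ⊳-νinp          = ⊳-νinp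
  ⊳-ren ρ ξ ⊳-νinp⁻¹        = ⊳-νinp⁻¹
  ⊳-ren ρ ξ ⊳-νout          = ⊳-νout
  ⊳-ren ρ ξ ⊳-νout⁻¹        = ⊳-νout⁻¹
  ⊳-ren ρ ξ (⊳-extrude {U = U} refl)   = ⊳-extrude (ren-square (λ _ → refl) (λ _ → refl) U)
  ⊳-ren ρ ξ (⊳-extrude⁻¹ {U = U} refl) = ⊳-extrude⁻¹ (ren-square (λ _ → refl) (λ _ → refl) U)
  ⊳-ren ρ ξ (⊳-β {T = T} refl) = ⊳-β (sym (ren-[] ρ ξ T))

  sub-thereᶜ : (σ : Sub Δ Γ Γ₁) (T : Term Δ Γ t) →
    sub (liftᶜ {s = s} σ) (ren there id T) ≡ ren there id (sub σ T)
  sub-thereᶜ σ = sub-ren λ _ → refl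

  ⊳-sub : ∀ {f} (σ : Sub Δ Γ Γ₁) {T U : Term Δ Γ t} → T ⊳[ f ] U → sub σ T ⊳[ f ] sub σ U
  ⊳-sub σ ⊳-refl          = ⊳-refl
  ⊳-sub σ (⊳-trans p q)   = ⊳-trans (⊳-sub σ p) (⊳-sub σ q)
  ⊳-sub σ (⊳-inp p)       = ⊳-inp (⊳-sub (liftᵛ σ) p)
  ⊳-sub σ (⊳-out p q)     = ⊳-out (⊳-sub σ p) (⊳-sub σ q)
  ⊳-sub σ (⊳-par p q)     = ⊳-par (⊳-sub σ p) (⊳-sub σ q)
  ⊳-sub σ (⊳-ν p)         = ⊳-ν (⊳-sub (liftᶜ σ) p)
  ⊳-sub σ (⊳-lam p)       = ⊳-lam (⊳-sub (liftᵛ σ) p)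
  ⊳-sub σ (⊳-app p q)     = ⊳-app (⊳-sub σ p) (⊳-sub σ q)
  ⊳-sub σ ⊳-assoc         = ⊳-assoc
  ⊳-sub σ ⊳-comm          = ⊳-comm
  ⊳-sub σ ⊳-unit          = ⊳-unit
  ⊳-sub σ ⊳-unit⁻¹        = ⊳-unit⁻¹
  ⊳-sub σ (⊳-swap {T = T} refl) =
    ⊳-swap (sub-ren (λ x → trans (ren-∘ (λ _ → refl) (λ _ → refl) (σ x))
                       (sym (trans (cong (ren swap id) (ren-∘ (λ _ → refl) (λ _ → refl) (σ x)))
                                   (ren-∘ (λ _ → refl) (λ _ → refl) (σ x))))) T)
  ⊳-sub σ ⊳-νinp          = ⊳-νinp
  ⊳-sub σ ⊳-νinp⁻¹        = ⊳-νinp⁻¹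
  ⊳-sub σ ⊳-νout          = ⊳-νout
  ⊳-sub σ ⊳-νout⁻¹        = ⊳-νout⁻¹
  ⊳-sub σ (⊳-extrude {U = U} refl)   = ⊳-extrude (sub-thereᶜ σ U)
  ⊳-sub σ (⊳-extrude⁻¹ {U = U} refl) = ⊳-extrude⁻¹ (sub-thereᶜ σ U)
  ⊳-sub σ (⊳-β {T = T} refl) = ⊳-β (sym (sub-single σ T))

  ⊳-liftᵛ : ∀ {f} {σ σ' : Sub Δ Γ Γ₁} → (∀ {t} (x : t ∈ Γ) → σ x ⊳[ f ] σ' x) →
    ∀ {t} (x : t ∈ s ∷ Γ) → liftᵛ σ x ⊳[ f ] liftᵛ σ' x
  ⊳-liftᵛ h (here p)  = ⊳-refl
  ⊳-liftᵛ h (there x) = ⊳-ren id there (h x)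

  ⊳-subˢ : ∀ {f} {σ σ' : Sub Δ Γ Γ₁} → (∀ {t} (x : t ∈ Γ) → σ x ⊳[ f ] σ' x) →
    (T : Term Δ Γ t) → sub σ T ⊳[ f ] sub σ' T
  ⊳-subˢ h 𝟎           = ⊳-refl
  ⊳-subˢ h (var x)     = h x
  ⊳-subˢ h (inp a T)   = ⊳-inp (⊳-subˢ (⊳-liftᵛ h) T)
  ⊳-subˢ h (out a O T) = ⊳-out (⊳-subˢ h O) (⊳-subˢ h T)
  ⊳-subˢ h (T ∥ U)     = ⊳-par (⊳-subˢ h T) (⊳-subˢ h U)
  ⊳-subˢ h (ν s T)     = ⊳-ν (⊳-subˢ (λ x → ⊳-ren there id (h x)) T)
  ⊳-subˢ h (lam e T)   = ⊳-lam (⊳-subˢ (⊳-liftᵛ h) T)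
  ⊳-subˢ h (app e T U) = ⊳-app (⊳-subˢ h T) (⊳-subˢ h U)

  ⊳-[] : ∀ {f} {T T' : Term Δ (s ∷ Γ) t} {U U' : Term Δ Γ s} →
    T ⊳[ f ] T' → U ⊳[ f ] U' → T [ U ] ⊳[ f ] T' [ U' ]
  ⊳-[] {T' = T'} p q =
    ⊳-trans (⊳-sub _ p) (⊳-subˢ (λ { (here refl) → q ; (there x) → ⊳-refl }) T')

  ⊳-extrudeʳ : ∀ {f T T'} {U : Term (s ∷ Δ) Γ ◇} → T' ≡ ren there id T →
    ν s (T' ∥ U) ⊳[ f ] T ∥ ν s U
  ⊳-extrudeʳ eq = ⊳-trans (⊳-ν ⊳-comm) (⊳-trans (⊳-extrude eq) ⊳-comm)

  ⊳-commʳ : ∀ {f} {T U V : Term Δ Γ ◇} → (T ∥ U) ∥ V ⊳[ f ] (T ∥ V) ∥ U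
  ⊳-commʳ = ⊳-trans ⊳-assoc (⊳-trans (⊳-par ⊳-refl ⊳-comm) ⊳-assoc⁻¹)

  -- Forward simulation

  infix 4 _⟶?_

  data _⟶?_ {Δ Γ : Ctx} : Term Δ Γ t → Term Δ Γ t → Set where
    stay : {T : Term Δ Γ t} → T ⟶? T
    step : {T U : Term Δ Γ t} → T ⟶ U → T ⟶? U

  ?-map : (f : Term Δ Γ s → Term Δ₁ Γ₁ t) → (∀ {T U} → T ⟶ U → f T ⟶ f U) →
    ∀ {T U} → T ⟶? U → f T ⟶? f U
  ?-map f g stay     = stay
  ?-map f g (step r) = step (g r)

  ?⇒* : {T U : Term Δ Γ t} → T ⟶? U → T ⟶* U
  ?⇒* stay     = ε
  ?⇒* (step r) = r ◅ ε

  ⊳-lam⁻¹ : ∀ {f α} {e : cod α ≡ t} {T : Term Δ (↑ dom α ∷ Γ) t} {U} → lam e T ⊳[ f ] U →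
    ∃ λ T' → U ≡ lam e T' × T ⊳[ f ] T'
  ⊳-lam⁻¹ ⊳-refl = _ , refl , ⊳-refl
  ⊳-lam⁻¹ (⊳-trans p q) with ⊳-lam⁻¹ p
  ... | _ , refl , p' with ⊳-lam⁻¹ q
  ...   | _ , refl , q' = _ , refl , ⊳-trans p' q'
  ⊳-lam⁻¹ (⊳-lam p) = _ , refl , p

  ⊳-head : ∀ {f} {T T' U : Term Δ Γ t} → T ⊳[ f ] U → T ⟶ T' →
    ∃ λ U' → U ⟶? U' × T' ⊳[ f ] U'
  ⊳-head? : ∀ {f} {T T' U : Term Δ Γ t} → T ⊳[ f ] U → T ⟶? T' →
    ∃ λ U' → U ⟶? U' × T' ⊳[ f ] U'
  ⊳-head? p stay     = _ , stay , p
  ⊳-head? p (step r) = ⊳-head p r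

  ⊳-head ⊳-refl r = _ , step r , ⊳-refl
  ⊳-head (⊳-trans p q) r with ⊳-head p r
  ... | _ , r' , p' with ⊳-head? q r'
  ...   | _ , r'' , q' = _ , r'' , ⊳-trans p' q'
  ⊳-head (⊳-par p q) (∥ˡ r) with ⊳-head p r
  ... | _ , r' , p' = _ , ?-map (_∥ _) ∥ˡ r' , ⊳-par p' q
  ⊳-head (⊳-par p q) (∥ʳ r) with ⊳-head q r
  ... | _ , r' , q' = _ , ?-map (_ ∥_) ∥ʳ r' , ⊳-par p q'
  ⊳-head (⊳-ν p) (under-ν r) with ⊳-head p r
  ... | _ , r' , p' = _ , ?-map (ν _) under-ν r' , ⊳-ν p'
  ⊳-head (⊳-app p q) (head-β refl) with ⊳-lam⁻¹ p
  ... | _ , refl , p' = _ , step (head-β refl) , ⊳-[] p' q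
  ⊳-head (⊳-app p q) (appˡ r) with ⊳-head p r
  ... | _ , r' , p' = _ , ?-map (λ T → app _ T _) appˡ r' , ⊳-app p' q
  ⊳-head ⊳-assoc (∥ˡ (∥ˡ r)) = _ , step (∥ˡ r) , ⊳-assoc
  ⊳-head ⊳-assoc (∥ˡ (∥ʳ r)) = _ , step (∥ʳ (∥ˡ r)) , ⊳-assoc
  ⊳-head ⊳-assoc (∥ʳ r)      = _ , step (∥ʳ (∥ʳ r)) , ⊳-assoc
  ⊳-head ⊳-comm (∥ˡ r)       = _ , step (∥ʳ r) , ⊳-comm
  ⊳-head ⊳-comm (∥ʳ r)       = _ , step (∥ˡ r) , ⊳-comm
  ⊳-head ⊳-unit (∥ˡ r)       = _ , step r , ⊳-unit
  ⊳-head ⊳-unit⁻¹ r          = _ , step (∥ˡ r) , ⊳-unit⁻¹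
  ⊳-head (⊳-swap refl) (under-ν (under-ν r)) =
    _ , step (under-ν (under-ν (⟶-ren swap id r))) , ⊳-swap refl
  ⊳-head ⊳-νinp (under-ν ())
  ⊳-head ⊳-νout (under-ν ())
  ⊳-head (⊳-extrude eq) (under-ν (∥ˡ r)) = _ , step (∥ˡ (under-ν r)) , ⊳-extrude eq
  ⊳-head (⊳-extrude {U = U} refl) (under-ν (∥ʳ r)) with ⟶-ren⁻¹ there id U r
  ... | _ , r' , eq = _ , step (∥ʳ r') , ⊳-extrude eq
  ⊳-head (⊳-extrude⁻¹ eq) (∥ˡ (under-ν r)) = _ , step (under-ν (∥ˡ r)) , ⊳-extrude⁻¹ eq
  ⊳-head (⊳-extrude⁻¹ refl) (∥ʳ r) = _ , step (under-ν (∥ʳ (⟶-ren there id r))) , ⊳-extrude⁻¹ refl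
  ⊳-head (⊳-β refl) (head-β refl) = _ , stay , ⊳-refl
  ⊳-head (⊳-β refl) (appˡ ())

  ⊳-head* : ∀ {f} {T T' U : Term Δ Γ t} → T ⊳[ f ] U → T ⟶* T' →
    ∃ λ U' → U ⟶* U' × T' ⊳[ f ] U'
  ⊳-head* p ε = _ , ε , p
  ⊳-head* p (r ◅ rs) with ⊳-head p r
  ... | _ , r' , p' with ⊳-head* p' rs
  ...   | _ , rs' , p'' = _ , ?⇒* r' ◅◅ rs' , p''

  Ext-id : ∀ k → Ext-⊆ {Γ} k id ≐ id
  Ext-id (rcv s) = ∷⁺ʳ-id (λ _ → refl)
  Ext-id (snd s) = λ _ → refl
  Ext-id tau     = λ _ → refl

  result-renᶜ : (ρ : Δ ⊆ Δ₁) {T : Term Δ Γ ◇} → ∀ {k a} (d : T ↓ k ∙ a) x →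
    result (renᵈ ρ id d) (renᵃ ρ id k x) ≡ ren ρ id (result d x)
  result-renᶜ ρ {k = k} d x = trans (result-renᵈ ρ id d x) (ren-ext (λ _ → refl) (Ext-id k) (result d x))

  wk-renᶜ : (ρ : Δ ⊆ Δ₁) → ∀ k (T : Term Δ Γ ◇) → wk k (ren ρ id T) ≡ ren ρ id (wk k T)
  wk-renᶜ ρ k T = trans (wk-ren ρ id k T) (ren-ext (λ _ → refl) (Ext-id k) (wk k T))

  wk-𝟎 : ∀ k → wk {Δ} {Γ} k 𝟎 ≡ 𝟎
  wk-𝟎 (rcv s) = refl
  wk-𝟎 (snd s) = refl
  wk-𝟎 tau     = refl

  wk-∥ : ∀ k (T U : Term Δ Γ ◇) → wk k (T ∥ U) ≡ wk k T ∥ wk k U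
  wk-∥ (rcv s) T U = refl
  wk-∥ (snd s) T U = refl
  wk-∥ tau     T U = refl

  wk-ν : ∀ k (T : Term (s ∷ Δ) Γ ◇) → wk k (ν s T) ≡ ν s (wk k T)
  wk-ν (rcv s) T = cong (ν _) (ren-ext (∷⁺ʳ-id (λ _ → refl)) (λ _ → refl) T)
  wk-ν (snd s) T = refl
  wk-ν tau     T = refl

  ⊳-wk : ∀ {f} k {T U : Term Δ Γ ◇} → T ⊳[ f ] U → wk k T ⊳[ f ] wk k U
  ⊳-wk (rcv s) p = ⊳-ren id there p
  ⊳-wk (snd s) p = p
  ⊳-wk tau     p = p

  renᵃ-there : (F : Term Δ (t ∷ Γ) ◇) → renᵃ (there {x = s}) id (snd t) F ≡ ren there id F
  renᵃ-there F = ren-ext (λ _ → refl) (∷⁺ʳ-id (λ _ → refl)) F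

  -- Complements `result-renᵈ`, which speaks only of arguments that are themselves renamed; here the
  -- argument is arbitrary in the target context.
  result-renᵈ-∘ : {ρ : Δ ⊆ Δ₁} {ρ' : Δ₁ ⊆ Δ₂} {ρ'' : Δ ⊆ Δ₂} {ξ : Γ ⊆ Γ₁} {ξ' : Γ₁ ⊆ Γ₂} {ξ'' : Γ ⊆ Γ₂} →
    ρ' ∘ ρ ≐ ρ'' → ξ' ∘ ξ ≐ ξ'' → {T : Term Δ Γ ◇} → ∀ {k a} (d : T ↓ k ∙ a) x →
    result (renᵈ ρ' ξ' (renᵈ ρ ξ d)) x ≡ result (renᵈ ρ'' ξ'' d) x
  result-renᵈ-∘ h l (inp {T = T}) x = ren-∘ h (∷⁺ʳ-∘ l) T
  result-renᵈ-∘ h l (out {O = O} {T = T}) F = cong₂ (λ O T → F [ O ] ∥ T) (ren-∘ h l O) (ren-∘ h l T)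
  result-renᵈ-∘ h l (parˡ {k} {U = U} d) x =
    cong₂ (λ R V → R ∥ wk k V) (result-renᵈ-∘ h l d x) (ren-∘ h l U)
  result-renᵈ-∘ h l (parʳ {k} {T = T} d) x =
    cong₂ (λ R V → wk k V ∥ R) (result-renᵈ-∘ h l d x) (ren-∘ h l T)
  result-renᵈ-∘ h l (res {k = k} eq d) x =
    cong (ν _) (result-renᵈ-∘ (∷⁺ʳ-∘ h) l d (renᵃ there id k x))
  result-renᵈ-∘ {ρ'' = ρ''} {ξ'' = ξ''} h l (comˡ c d) x =
    trans (result-renᵈ-∘ h l d _) (cong (result (renᵈ ρ'' ξ'' d)) (result-renᵈ-∘ h l c tt))
  result-renᵈ-∘ {ρ'' = ρ''} {ξ'' = ξ''} h l (comʳ d c) x =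
    trans (result-renᵈ-∘ h l d _) (cong (result (renᵈ ρ'' ξ'' d)) (result-renᵈ-∘ h l c tt))

  result-mono : ∀ {f} {T : Term Δ Γ ◇} {a : Chan Δ s} (d : T ↓ snd s ∙ a) {F G} →
    F ⊳[ f ] G → result d F ⊳[ f ] result d G
  result-mono out        p = ⊳-par (⊳-[] p ⊳-refl) ⊳-refl
  result-mono (parˡ d)   p = ⊳-par (result-mono d p) ⊳-refl
  result-mono (parʳ d)   p = ⊳-par ⊳-refl (result-mono d p)
  result-mono (res eq d) p = ⊳-ν (result-mono d (⊳-ren there _ p))

  -- `V` mentions neither the received variable nor any name that the output extrudes, so scope
  -- extrusion moves it out of the receiver. Associativity of parallel composition across a
  -- communication rests on this.
  result-∥ : ∀ {f} {T : Term Δ Γ ◇} {a : Chan Δ s} (d : T ↓ snd s ∙ a) F V →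
    result d (F ∥ ren id there V) ⊳[ f ] result d F ∥ V
  result-∥ out F V = ⊳-trans (⊳-par (⊳-par ⊳-refl (⊳-≡ (there-[] V))) ⊳-refl) ⊳-commʳ
  result-∥ (parˡ d) F V = ⊳-trans (⊳-par (result-∥ d F V) ⊳-refl) ⊳-commʳ
  result-∥ (parʳ d) F V = ⊳-trans (⊳-par ⊳-refl (result-∥ d F V)) ⊳-assoc⁻¹
  result-∥ (res eq d) F V =
    ⊳-trans (⊳-ν (⊳-trans (⊳-≡ (cong (λ W → result d (_ ∥ W)) (ren-square (λ _ → refl) (λ _ → refl) V)))
                          (result-∥ d _ (ren there id V))))
      (⊳-extrude refl)

  swap-there : (x : u ∈ s ∷ Δ) → swap (there {x = t} x) ≡ ∷⁺ʳ s there x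
  swap-there (here p)  = refl
  swap-there (there x) = refl

  swap-∷⁺ʳ-there : (x : u ∈ t ∷ Δ) → swap (∷⁺ʳ t (there {x = s}) x) ≡ there x
  swap-∷⁺ʳ-there (here p)  = refl
  swap-∷⁺ʳ-there (there x) = refl

  ∷⁺ʳ-id-∘ : (x : u ∈ s ∷ Γ) → ∷⁺ʳ s id (∷⁺ʳ s id x) ≡ ∷⁺ʳ s id x
  ∷⁺ʳ-id-∘ (here p)  = refl
  ∷⁺ʳ-id-∘ (there x) = refl

  -- The output does not know the name private to the receiver, so the scope of that name commutes
  -- with the scopes that the output extrudes: `⊳-extrude` passes parallel components and `⊳-swap`
  -- passes restrictions.
  result-ν : ∀ {f} {T : Term Δ Γ ◇} {a : Chan Δ t} (d : T ↓ snd t ∙ a) (F : Term (s ∷ Δ) (t ∷ Γ) ◇) →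
    ν s (result (renᵈ there id d) F) ⊳[ f ] result d (ν s F)
  result-ν out F = ⊳-trans (⊳-extrude refl) (⊳-par (⊳-≡ (sym (ν-[] F))) ⊳-refl)
  result-ν (parˡ d) F = ⊳-trans (⊳-extrude refl) (⊳-par (result-ν d F) ⊳-refl)
  result-ν (parʳ d) F = ⊳-trans (⊳-extrudeʳ refl) (⊳-par ⊳-refl (result-ν d F))
  result-ν {t = t} {s = s} (res {s = u} eq d) F =
    ⊳-trans (⊳-swap {T' = result (renᵈ there id d) F'} (sym eq₁)) (⊳-ν (result-ν d F'))
    where
    F' : Term (s ∷ u ∷ _) _ ◇
    F' = ren (∷⁺ʳ s there) (∷⁺ʳ t id) F
    eq₁ : ren swap id (result (renᵈ (∷⁺ʳ u there) id d) (renᵃ there id (snd t) F)) ≡ result (renᵈ there id d) F'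
    eq₁ = trans (sym (result-renᶜ swap (renᵈ (∷⁺ʳ u there) id d) _))
            (trans (cong (result (renᵈ swap id (renᵈ (∷⁺ʳ u there) id d)))
                     (ren-∘ swap-there ∷⁺ʳ-id-∘ F))
                   (result-renᵈ-∘ swap-∷⁺ʳ-there (λ _ → refl) d F'))

  renˢ-inj : {ρ : Δ ⊆ Δ₁} → Inj ρ → ∀ k (a b : Subj Δ k) → renˢ ρ k a ≡ renˢ ρ k b → a ≡ b
  renˢ-inj i (rcv s) a b eq = renᶜ-inj i a b eq
  renˢ-inj i (snd s) a b eq = renᶜ-inj i a b eq
  renˢ-inj i tau     a b eq = refl

  newest≢there : {Δ : Ctx} (a : Chan Δ s) → renᶜ there a ≡ newest → ⊥
  newest≢there (free k)  ()
  newest≢there (bound x) ()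

  extrude-parˡ : ∀ {f k} (R : Term (s ∷ Δ) (Ext k Γ) ◇) (U : Term Δ Γ ◇) →
    ν s (R ∥ wk k (ren there id U)) ⊳[ f ] ν s R ∥ wk k U
  extrude-parˡ {k = k} R U = ⊳-extrude (wk-renᶜ there k U)

  extrude-parʳ : ∀ {f k a} (T : Term (s ∷ Δ) Γ ◇) {U : Term Δ Γ ◇} (d : U ↓ k ∙ a) x →
    ν s (wk k T ∥ result (renᵈ there id d) (renᵃ there id k x)) ⊳[ f ] wk k (ν s T) ∥ result d x
  extrude-parʳ {k = k} T d x =
    ⊳-trans (⊳-extrude (result-renᶜ there d x)) (⊳-par (⊳-≡ (sym (wk-ν k T))) ⊳-refl)

  extrude-comʳ : ∀ {f a b} {T : Term (s ∷ Δ) Γ ◇} {U : Term Δ Γ ◇} (d : T ↓ snd t ∙ b) (c : U ↓ rcv t ∙ a) →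
    ν s (result d (result (renᵈ there id c) tt)) ⊳[ f ] ν s (result d (renᵃ there id (snd t) (result c tt)))
  extrude-comʳ d c = ⊳-≡ (cong (λ F → ν _ (result d F)) (result-renᵈ there id c tt))

  renˢ-swap : ∀ k (a : Subj Δ k) →
    renˢ there k (renˢ there k a) ≡ renˢ swap k (renˢ (there {x = s}) k (renˢ (there {x = t}) k a))
  renˢ-swap (rcv s) (free n)  = refl
  renˢ-swap (rcv s) (bound x) = refl
  renˢ-swap (snd s) (free n)  = refl
  renˢ-swap (snd s) (bound x) = refl
  renˢ-swap tau     a         = refl

  renᵃ-swap : ∀ k (x : Arg k Δ Γ) →
    renᵃ there id k (renᵃ there id k x) ≡ renᵃ swap id k (renᵃ (there {x = s}) id k (renᵃ (there {x = t}) id k x))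
  renᵃ-swap (rcv s) x = refl
  renᵃ-swap (snd s) F =
    trans (ren-∘ (λ _ → refl) ∷⁺ʳ-id-∘ F)
      (sym (trans (cong (ren swap _) (ren-∘ (λ _ → refl) ∷⁺ʳ-id-∘ F)) (ren-∘ (λ _ → refl) ∷⁺ʳ-id-∘ F)))
  renᵃ-swap tau     x = refl

  -- An application commits to nothing, so `⊳-β` contributes no case, and every law carries one
  -- commitment to one commitment without head steps in between. Results are compared at each
  -- argument; for outputs this relates different placements of the extruded scopes.
  ⊳-commit : ∀ {f} {T U : Term Δ Γ ◇} → T ⊳[ f ] U → ∀ {k a} (d : T ↓ k ∙ a) →
    Σ (U ↓ k ∙ a) λ d' → ∀ x → result d x ⊳[ f ] result d' x
  ⊳-commit ⊳-refl d = d , λ x → ⊳-refl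
  ⊳-commit (⊳-trans p q) d with ⊳-commit p d
  ... | d' , h with ⊳-commit q d'
  ...   | d'' , h' = d'' , λ x → ⊳-trans (h x) (h' x)
  ⊳-commit (⊳-inp p) inp = inp , λ x → p
  ⊳-commit (⊳-out p q) out = out , λ F → ⊳-par (⊳-[] {T = F} ⊳-refl p) q
  ⊳-commit (⊳-par p q) (parˡ {k} d) with ⊳-commit p d
  ... | d' , h = parˡ d' , λ x → ⊳-par (h x) (⊳-wk k q)
  ⊳-commit (⊳-par p q) (parʳ {k} d) with ⊳-commit q d
  ... | d' , h = parʳ d' , λ x → ⊳-par (⊳-wk k p) (h x)
  ⊳-commit (⊳-par p q) (comˡ c d) with ⊳-commit p c | ⊳-commit q d
  ... | c' , hc | d' , hd = comˡ c' d' , λ x → ⊳-trans (hd _) (result-mono d' (hc tt))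
  ⊳-commit (⊳-par p q) (comʳ d c) with ⊳-commit q c | ⊳-commit p d
  ... | c' , hc | d' , hd = comʳ d' c' , λ x → ⊳-trans (hd _) (result-mono d' (hc tt))
  ⊳-commit (⊳-ν p) (res eq d) with ⊳-commit p d
  ... | d' , h = res eq d' , λ x → ⊳-ν (h _)
  ⊳-commit ⊳-assoc (parˡ (parˡ {k} {U = U} d)) =
    parˡ d , λ x → ⊳-trans ⊳-assoc (⊳-par ⊳-refl (⊳-≡ (sym (wk-∥ k U _))))
  ⊳-commit ⊳-assoc (parˡ (parʳ d)) = parʳ (parˡ d) , λ x → ⊳-assoc
  ⊳-commit ⊳-assoc (parʳ {k} {T = T ∥ U} d) =
    parʳ (parʳ d) , λ x → ⊳-trans (⊳-par (⊳-≡ (wk-∥ k T U)) ⊳-refl) ⊳-assoc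
  ⊳-commit ⊳-assoc (parˡ (comˡ c d)) = comˡ c (parˡ d) , λ x → ⊳-refl
  ⊳-commit (⊳-assoc {V = V}) (parˡ (comʳ d c)) = comʳ d (parˡ c) , λ x → ⊳-sym (result-∥ d (result c tt) V)
  ⊳-commit (⊳-assoc {U = U}) (comˡ (parˡ c) d) =
    comˡ c (parʳ d) , λ x → ⊳-trans (result-∥ d (result c tt) U) ⊳-comm
  ⊳-commit (⊳-assoc {T = T}) (comˡ (parʳ c) d) =
    parʳ (comˡ c d) , λ x → ⊳-trans (result-mono d ⊳-comm) (⊳-trans (result-∥ d (result c tt) T) ⊳-comm)
  ⊳-commit (⊳-assoc {U = U}) (comʳ (parˡ d) c) =
    comʳ d (parʳ c) , λ x → ⊳-sym (⊳-trans (result-mono d ⊳-comm) (result-∥ d (result c tt) U))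
  ⊳-commit ⊳-assoc (comʳ (parʳ d) c) = parʳ (comʳ d c) , λ x → ⊳-refl
  ⊳-commit ⊳-comm (parˡ d)   = parʳ d , λ x → ⊳-comm
  ⊳-commit ⊳-comm (parʳ d)   = parˡ d , λ x → ⊳-comm
  ⊳-commit ⊳-comm (comˡ c d) = comʳ d c , λ x → ⊳-refl
  ⊳-commit ⊳-comm (comʳ d c) = comˡ c d , λ x → ⊳-refl
  ⊳-commit ⊳-unit (parˡ {k} d) = d , λ x → ⊳-trans (⊳-par ⊳-refl (⊳-≡ (wk-𝟎 k))) ⊳-unit
  ⊳-commit ⊳-unit⁻¹ {k} d = parˡ d , λ x → ⊳-trans ⊳-unit⁻¹ (⊳-par ⊳-refl (⊳-≡ (sym (wk-𝟎 k))))
  ⊳-commit (⊳-swap {s = s} {t = t} refl) (res {k = k} {a} refl (res refl d)) =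
    res refl (res (renˢ-swap k a) (renᵈ swap id d)) ,
    λ x → ⊳-swap (trans (cong (result (renᵈ swap id d)) (renᵃ-swap k x)) (result-renᶜ swap d _))
  ⊳-commit ⊳-νinp (res {a = a} eq inp) = ⊥-elim (newest≢there a eq)
  ⊳-commit ⊳-νout (res {a = a} eq out) = ⊥-elim (newest≢there a eq)
  ⊳-commit (⊳-extrude {U = U} refl) (res eq (parˡ d)) = parˡ (res eq d) , λ x → extrude-parˡ _ U
  ⊳-commit (⊳-extrude {U = U} refl) (res {k = k} {a} eq (parʳ {T = T} d)) with renᵈ⁻¹ there id there-inj U d
  ... | a₀ , d₀ , refl , refl with renˢ-inj there-inj k a a₀ eq
  ...   | refl = parʳ d₀ , λ x → extrude-parʳ T d₀ x
  ⊳-commit (⊳-extrude {U = U} refl) (res eq (comˡ c d)) with renᵈ⁻¹ there id there-inj U d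
  ... | a₀ , d₀ , refl , refl = comˡ (res refl c) d₀ , λ x → result-ν d₀ (result c tt)
  ⊳-commit (⊳-extrude {U = U} refl) (res eq (comʳ d c)) with renᵈ⁻¹ there id there-inj U c
  ... | a₀ , c₀ , refl , refl = comʳ (res refl d) c₀ , λ x → extrude-comʳ d c₀
  ⊳-commit (⊳-extrude⁻¹ {U = U} refl) (parˡ (res eq d)) = res eq (parˡ d) , λ x → ⊳-sym (extrude-parˡ _ U)
  ⊳-commit (⊳-extrude⁻¹ {T = T} refl) (parʳ d) = res refl (parʳ (renᵈ there id d)) , λ x → ⊳-sym (extrude-parʳ T d x)
  ⊳-commit (⊳-extrude⁻¹ refl) (comˡ (res refl c) d) =
    res refl (comˡ c (renᵈ there id d)) , λ x → ⊳-sym (result-ν d (result c tt))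
  ⊳-commit (⊳-extrude⁻¹ refl) (comʳ (res refl d) c) =
    res refl (comʳ d (renᵈ there id c)) , λ x → ⊳-sym (extrude-comʳ d c)

  -- Standard reduction and backward simulation

  infix 4 _⇛_

  -- Reduction sequences in standard order: head reduction to the outermost
  -- constructor, then standard reduction of its components.  In this form
  -- head steps of the target are absorbed without any postponement argument.
  data _⇛_ {Δ Γ : Ctx} : Term Δ Γ t → Term Δ Γ t → Set where
    ⇛-𝟎   : ∀ {T} → T ⟶* 𝟎 → T ⇛ 𝟎
    ⇛-var : ∀ {T} {x : t ∈ Γ} → T ⟶* var x → T ⇛ var x
    ⇛-inp : ∀ {T} {a : Chan Δ s} {U U'} → T ⟶* inp a U → U ⇛ U' → T ⇛ inp a U'
    ⇛-out : ∀ {T} {a : Chan Δ s} {O O' U U'} → T ⟶* out a O U → O ⇛ O' → U ⇛ U' → T ⇛ out a O' U'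
    ⇛-par : ∀ {T U U' V V'} → T ⟶* U ∥ V → U ⇛ U' → V ⇛ V' → T ⇛ U' ∥ V'
    ⇛-ν   : ∀ {T U U'} → T ⟶* ν s U → U ⇛ U' → T ⇛ ν s U'
    ⇛-lam : ∀ {α T} {e : cod α ≡ t} {U U'} → T ⟶* lam e U → U ⇛ U' → T ⇛ lam e U'
    ⇛-app : ∀ {α T} {e : cod α ≡ t} {U U' V V'} → T ⟶* app e U V → U ⇛ U' → V ⇛ V' → T ⇛ app e U' V'

  ⇛-prepend : {T T' U : Term Δ Γ t} → T ⟶* T' → T' ⇛ U → T ⇛ U
  ⇛-prepend r (⇛-𝟎 rs)       = ⇛-𝟎 (r ◅◅ rs)
  ⇛-prepend r (⇛-var rs)     = ⇛-var (r ◅◅ rs)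
  ⇛-prepend r (⇛-inp rs p)   = ⇛-inp (r ◅◅ rs) p
  ⇛-prepend r (⇛-out rs p q) = ⇛-out (r ◅◅ rs) p q
  ⇛-prepend r (⇛-par rs p q) = ⇛-par (r ◅◅ rs) p q
  ⇛-prepend r (⇛-ν rs p)     = ⇛-ν (r ◅◅ rs) p
  ⇛-prepend r (⇛-lam rs p)   = ⇛-lam (r ◅◅ rs) p
  ⇛-prepend r (⇛-app rs p q) = ⇛-app (r ◅◅ rs) p q

  ⇛-refl : {T : Term Δ Γ t} → T ⇛ T
  ⇛-refl {T = 𝟎}         = ⇛-𝟎 ε
  ⇛-refl {T = var x}     = ⇛-var ε
  ⇛-refl {T = inp a T}   = ⇛-inp ε ⇛-refl
  ⇛-refl {T = out a O T} = ⇛-out ε ⇛-refl ⇛-refl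
  ⇛-refl {T = T ∥ U}     = ⇛-par ε ⇛-refl ⇛-refl
  ⇛-refl {T = ν s T}     = ⇛-ν ε ⇛-refl
  ⇛-refl {T = lam e T}   = ⇛-lam ε ⇛-refl
  ⇛-refl {T = app e T U} = ⇛-app ε ⇛-refl ⇛-refl

  ⟶*-ren : (ρ : Δ ⊆ Δ₁) (ξ : Γ ⊆ Γ₁) {T U : Term Δ Γ t} → T ⟶* U → ren ρ ξ T ⟶* ren ρ ξ U
  ⟶*-ren ρ ξ = gmap (ren ρ ξ) (⟶-ren ρ ξ)

  ⟶*-sub : (σ : Sub Δ Γ Γ₁) {T U : Term Δ Γ t} → T ⟶* U → sub σ T ⟶* sub σ U
  ⟶*-sub σ = gmap (sub σ) (⟶-sub σ)

  ⇛-ren : (ρ : Δ ⊆ Δ₁) (ξ : Γ ⊆ Γ₁) {T U : Term Δ Γ t} → T ⇛ U → ren ρ ξ T ⇛ ren ρ ξ U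
  ⇛-ren ρ ξ (⇛-𝟎 rs)       = ⇛-𝟎 (⟶*-ren ρ ξ rs)
  ⇛-ren ρ ξ (⇛-var rs)     = ⇛-var (⟶*-ren ρ ξ rs)
  ⇛-ren ρ ξ (⇛-inp rs p)   = ⇛-inp (⟶*-ren ρ ξ rs) (⇛-ren ρ (∷⁺ʳ _ ξ) p)
  ⇛-ren ρ ξ (⇛-out rs p q) = ⇛-out (⟶*-ren ρ ξ rs) (⇛-ren ρ ξ p) (⇛-ren ρ ξ q)
  ⇛-ren ρ ξ (⇛-par rs p q) = ⇛-par (⟶*-ren ρ ξ rs) (⇛-ren ρ ξ p) (⇛-ren ρ ξ q)
  ⇛-ren ρ ξ (⇛-ν rs p)     = ⇛-ν (⟶*-ren ρ ξ rs) (⇛-ren (∷⁺ʳ _ ρ) ξ p)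
  ⇛-ren ρ ξ (⇛-lam rs p)   = ⇛-lam (⟶*-ren ρ ξ rs) (⇛-ren ρ (∷⁺ʳ _ ξ) p)
  ⇛-ren ρ ξ (⇛-app rs p q) = ⇛-app (⟶*-ren ρ ξ rs) (⇛-ren ρ ξ p) (⇛-ren ρ ξ q)

  ⇛-liftᵛ : {σ σ' : Sub Δ Γ Γ₁} → (∀ {t} (x : t ∈ Γ) → σ x ⇛ σ' x) →
    ∀ {t} (x : t ∈ s ∷ Γ) → liftᵛ σ x ⇛ liftᵛ σ' x
  ⇛-liftᵛ h (here p)  = ⇛-refl
  ⇛-liftᵛ h (there x) = ⇛-ren id there (h x)

  ⇛-sub : {σ σ' : Sub Δ Γ Γ₁} → (∀ {t} (x : t ∈ Γ) → σ x ⇛ σ' x) →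
    {T U : Term Δ Γ t} → T ⇛ U → sub σ T ⇛ sub σ' U
  ⇛-sub h (⇛-𝟎 rs)               = ⇛-𝟎 (⟶*-sub _ rs)
  ⇛-sub h (⇛-var {x = x} rs)     = ⇛-prepend (⟶*-sub _ rs) (h x)
  ⇛-sub h (⇛-inp rs p)           = ⇛-inp (⟶*-sub _ rs) (⇛-sub (⇛-liftᵛ h) p)
  ⇛-sub h (⇛-out rs p q)         = ⇛-out (⟶*-sub _ rs) (⇛-sub h p) (⇛-sub h q)
  ⇛-sub h (⇛-par rs p q)         = ⇛-par (⟶*-sub _ rs) (⇛-sub h p) (⇛-sub h q)
  ⇛-sub h (⇛-ν rs p)             = ⇛-ν (⟶*-sub _ rs) (⇛-sub (λ x → ⇛-ren there id (h x)) p)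
  ⇛-sub h (⇛-lam rs p)           = ⇛-lam (⟶*-sub _ rs) (⇛-sub (⇛-liftᵛ h) p)
  ⇛-sub h (⇛-app rs p q)         = ⇛-app (⟶*-sub _ rs) (⇛-sub h p) (⇛-sub h q)

  ⇛-[] : {T T' : Term Δ (s ∷ Γ) t} {U U' : Term Δ Γ s} → T ⇛ T' → U ⇛ U' → T [ U ] ⇛ T' [ U' ]
  ⇛-[] p q = ⇛-sub (λ { (here refl) → q ; (there x) → ⇛-refl }) p

  ⇛-head : {T U U' : Term Δ Γ t} → T ⇛ U → U ⟶ U' → T ⇛ U'
  ⇛-head (⇛-par rs p q) (∥ˡ r)     = ⇛-par rs (⇛-head p r) q
  ⇛-head (⇛-par rs p q) (∥ʳ r)     = ⇛-par rs p (⇛-head q r)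
  ⇛-head (⇛-ν rs p) (under-ν r)    = ⇛-ν rs (⇛-head p r)
  ⇛-head (⇛-app rs p q) (appˡ r)   = ⇛-app rs (⇛-head p r) q
  -- Head steps lead to an application and then, in its function position, to an abstraction.
  -- Contracting that redex at once is again a head step, and the remaining standard reductions
  -- combine under substitution.
  ⇛-head (⇛-app rs (⇛-lam rs' p) q) (head-β refl) =
    ⇛-prepend (rs ◅◅ gmap (λ T → app _ T _) appˡ rs' ◅◅ head-β refl ◅ ε) (⇛-[] p q)

  ⇛-head* : {T U U' : Term Δ Γ t} → T ⇛ U → U ⟶* U' → T ⇛ U'
  ⇛-head* p ε        = p
  ⇛-head* p (r ◅ rs) = ⇛-head* (⇛-head p r) rs

  ArgRel : (∀ {Γ} → Term Δ Γ ◇ → Term Δ₁ Γ ◇ → Set) → ∀ k → Arg k Δ Γ → Arg k Δ₁ Γ → Set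
  ArgRel R (rcv s) x y = ⊤
  ArgRel R (snd s) F G = R F G
  ArgRel R tau     x y = ⊤

  renᵃ-⇛ : (ρ : Δ ⊆ Δ₁) (ξ : Γ ⊆ Γ₁) → ∀ k {x y : Arg k Δ Γ} →
    ArgRel _⇛_ k x y → ArgRel _⇛_ k (renᵃ ρ ξ k x) (renᵃ ρ ξ k y)
  renᵃ-⇛ ρ ξ (rcv s) r = tt
  renᵃ-⇛ ρ ξ (snd s) r = ⇛-ren ρ (∷⁺ʳ s ξ) r
  renᵃ-⇛ ρ ξ tau     r = tt

  ⇛-wk : ∀ k {T U : Term Δ Γ ◇} → T ⇛ U → wk k T ⇛ wk k U
  ⇛-wk (rcv s) p = ⇛-ren id there p
  ⇛-wk (snd s) p = p
  ⇛-wk tau     p = p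

  -- In standard order the steps that expose a prefix come first and are head steps; all others take
  -- place inside the result. Related rather than equal arguments are needed because a communication
  -- hands the result of one side to the other.
  ⇛-commit : {T U : Term Δ Γ ◇} → T ⇛ U → ∀ {k a} (d : U ↓ k ∙ a) →
    ∃ λ T' → T ⟶* T' × Σ (T' ↓ k ∙ a) λ d' → ∀ {x y} → ArgRel _⇛_ k x y → result d' x ⇛ result d y
  ⇛-commit (⇛-inp rs p) inp = _ , rs , inp , λ _ → p
  ⇛-commit (⇛-out rs p q) out = _ , rs , out , λ r → ⇛-par ε (⇛-[] r p) q
  ⇛-commit (⇛-par rs p q) (parˡ {k} d) with ⇛-commit p d
  ... | _ , rs' , d' , h = _ , rs ◅◅ gmap (_∥ _) ∥ˡ rs' , parˡ d' , λ r → ⇛-par ε (h r) (⇛-wk k q)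
  ⇛-commit (⇛-par rs p q) (parʳ {k} d) with ⇛-commit q d
  ... | _ , rs' , d' , h = _ , rs ◅◅ gmap (_ ∥_) ∥ʳ rs' , parʳ d' , λ r → ⇛-par ε (⇛-wk k p) (h r)
  ⇛-commit (⇛-par rs p q) (comˡ c d) with ⇛-commit p c | ⇛-commit q d
  ... | _ , rs₁ , c' , hc | _ , rs₂ , d' , hd =
    _ , rs ◅◅ gmap (_∥ _) ∥ˡ rs₁ ◅◅ gmap (_ ∥_) ∥ʳ rs₂ , comˡ c' d' , λ r → hd (hc tt)
  ⇛-commit (⇛-par rs p q) (comʳ d c) with ⇛-commit q c | ⇛-commit p d
  ... | _ , rs₁ , c' , hc | _ , rs₂ , d' , hd =
    _ , rs ◅◅ gmap (_ ∥_) ∥ʳ rs₁ ◅◅ gmap (_∥ _) ∥ˡ rs₂ , comʳ d' c' , λ r → hd (hc tt)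
  ⇛-commit (⇛-ν rs p) (res {k = k} eq d) with ⇛-commit p d
  ... | _ , rs' , d' , h =
    _ , rs ◅◅ gmap (ν _) under-ν rs' , res eq d' , λ r → ⇛-ν ε (h (renᵃ-⇛ there id k r))

  ⟶⇒≣ : {T U : Term Δ Γ t} → T ⟶ U → T ≣ U
  ⟶⇒≣ (head-β refl) = β
  ⟶⇒≣ (appˡ r)      = app-cong (⟶⇒≣ r) ≣-refl
  ⟶⇒≣ (∥ˡ r)        = ∥-cong (⟶⇒≣ r) ≣-refl
  ⟶⇒≣ (∥ʳ r)        = ∥-cong ≣-refl (⟶⇒≣ r)
  ⟶⇒≣ (under-ν r)   = ν-cong (⟶⇒≣ r)

  ⟶*⇒≣ : {T U : Term Δ Γ t} → T ⟶* U → T ≣ U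
  ⟶*⇒≣ ε        = ≣-refl
  ⟶*⇒≣ (r ◅ rs) = ≣-trans (⟶⇒≣ r) (⟶*⇒≣ rs)

  ⇛⇒≣ : {T U : Term Δ Γ t} → T ⇛ U → T ≣ U
  ⇛⇒≣ (⇛-𝟎 rs)       = ⟶*⇒≣ rs
  ⇛⇒≣ (⇛-var rs)     = ⟶*⇒≣ rs
  ⇛⇒≣ (⇛-inp rs p)   = ≣-trans (⟶*⇒≣ rs) (inp-cong (⇛⇒≣ p))
  ⇛⇒≣ (⇛-out rs p q) = ≣-trans (⟶*⇒≣ rs) (out-cong (⇛⇒≣ p) (⇛⇒≣ q))
  ⇛⇒≣ (⇛-par rs p q) = ≣-trans (⟶*⇒≣ rs) (∥-cong (⇛⇒≣ p) (⇛⇒≣ q))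
  ⇛⇒≣ (⇛-ν rs p)     = ≣-trans (⟶*⇒≣ rs) (ν-cong (⇛⇒≣ p))
  ⇛⇒≣ (⇛-lam rs p)   = ≣-trans (⟶*⇒≣ rs) (lam-cong (⇛⇒≣ p))
  ⇛⇒≣ (⇛-app rs p q) = ≣-trans (⟶*⇒≣ rs) (app-cong (⇛⇒≣ p) (⇛⇒≣ q))

  -- Structural congruence as a chain of oriented links

  data Link {Δ Γ : Ctx} : Term Δ Γ t → Term Δ Γ t → Set where
    fwd : {T U : Term Δ Γ t} → T ⊳[ reducing ] U → Link T U
    bwd : {T U : Term Δ Γ t} → U ⇛ T → Link T U

  link-map : (f : Term Δ Γ s → Term Δ₁ Γ₁ t) →
    (∀ {T U} → T ⊳[ reducing ] U → f T ⊳[ reducing ] f U) → (∀ {T U} → T ⇛ U → f T ⇛ f U) →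
    ∀ {T U} → Star Link T U → Star Link (f T) (f U)
  link-map f g h = gmap f λ { (fwd p) → fwd (g p) ; (bwd p) → bwd (h p) }

  -- Both directions are built at once because a chain cannot be reversed link by link: a forward
  -- link may mix β with structural laws, and its converse need not be a link of either sort.
  Links : Term Δ Γ t → Term Δ Γ t → Set
  Links T U = Star Link T U × Star Link U T

  links-map : (f : Term Δ Γ s → Term Δ₁ Γ₁ t) →
    (∀ {T U} → T ⊳[ reducing ] U → f T ⊳[ reducing ] f U) → (∀ {T U} → T ⇛ U → f T ⇛ f U) →
    ∀ {T U} → Links T U → Links (f T) (f U)
  links-map f g h (p , q) = link-map f g h p , link-map f g h q

  links-trans : {T U V : Term Δ Γ t} → Links T U → Links U V → Links T V
  links-trans (p , q) (p' , q') = p ◅◅ p' , q' ◅◅ q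

  links-exact : {T U : Term Δ Γ t} → (∀ {f} → T ⊳[ f ] U) → Links T U
  links-exact p = fwd p ◅ ε , fwd (⊳-sym p) ◅ ε

  ≣⇒links : {T U : Term Δ Γ t} → T ≣ U → Links T U
  ≣⇒links ≣-refl        = ε , ε
  ≣⇒links (≣-sym p)     with ≣⇒links p
  ... | q , r = r , q
  ≣⇒links (≣-trans p q) = links-trans (≣⇒links p) (≣⇒links q)
  ≣⇒links (inp-cong p)  = links-map (inp _) ⊳-inp (⇛-inp ε) (≣⇒links p)
  ≣⇒links (out-cong p q) = links-trans
    (links-map (λ O → out _ O _) (λ r → ⊳-out r ⊳-refl) (λ r → ⇛-out ε r ⇛-refl) (≣⇒links p))
    (links-map (out _ _) (⊳-out ⊳-refl) (⇛-out ε ⇛-refl) (≣⇒links q))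
  ≣⇒links (∥-cong p q)  = links-trans
    (links-map (_∥ _) (λ r → ⊳-par r ⊳-refl) (λ r → ⇛-par ε r ⇛-refl) (≣⇒links p))
    (links-map (_ ∥_) (⊳-par ⊳-refl) (⇛-par ε ⇛-refl) (≣⇒links q))
  ≣⇒links (ν-cong p)    = links-map (ν _) ⊳-ν (⇛-ν ε) (≣⇒links p)
  ≣⇒links (lam-cong p)  = links-map (lam _) ⊳-lam (⇛-lam ε) (≣⇒links p)
  ≣⇒links (app-cong p q) = links-trans
    (links-map (λ T → app _ T _) (λ r → ⊳-app r ⊳-refl) (λ r → ⇛-app ε r ⇛-refl) (≣⇒links p))
    (links-map (app _ _) (⊳-app ⊳-refl) (⇛-app ε ⇛-refl) (≣⇒links q))
  ≣⇒links ∥-assoc       = links-exact ⊳-assoc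
  ≣⇒links ∥-comm        = links-exact ⊳-comm
  ≣⇒links ∥-identity    = links-exact ⊳-unit
  ≣⇒links ν-swap        = links-exact (⊳-swap refl)
  ≣⇒links ν-inp         = links-exact ⊳-νinp
  ≣⇒links ν-out         = links-exact ⊳-νout
  ≣⇒links ν-extrude     = links-exact (⊳-extrude refl)
  ≣⇒links β             = fwd (⊳-β refl) ◅ ε , bwd (⇛-prepend (head-β refl ◅ ε) ⇛-refl) ◅ ε

  link⇒≣ : {T U : Term Δ Γ t} → Star Link T U → T ≣ U
  link⇒≣ ε            = ≣-refl
  link⇒≣ (fwd p ◅ ps) = ≣-trans (⊳⇒≣ p) (link⇒≣ ps)
  link⇒≣ (bwd p ◅ ps) = ≣-trans (≣-sym (⇛⇒≣ p)) (link⇒≣ ps)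

  -- Each link is preserved by `⊳-ren` or `⇛-ren`; passing through the chain avoids a further
  -- induction on `≣`.
  ≣-ren : (ρ : Δ ⊆ Δ₁) (ξ : Γ ⊆ Γ₁) {T U : Term Δ Γ t} → T ≣ U → ren ρ ξ T ≣ ren ρ ξ U
  ≣-ren ρ ξ p = link⇒≣ (link-map (ren ρ ξ) (⊳-ren ρ ξ) (⇛-ren ρ ξ) (proj₁ (≣⇒links p)))

  ≣-sub : (σ : Sub Δ Γ Γ₁) {T U : Term Δ Γ t} → T ≣ U → sub σ T ≣ sub σ U
  ≣-sub σ p = link⇒≣ (link-map (sub σ) (⊳-sub σ) (⇛-sub (λ _ → ⇛-refl)) (proj₁ (≣⇒links p)))

  ≡⇒≣ : {T U : Term Δ Γ t} → T ≡ U → T ≣ U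
  ≡⇒≣ refl = ≣-refl

  -- Weak only with respect to head reduction, which `≣` contains; thus no transition is hidden in
  -- it.
  Commits : Term Δ Γ ◇ → ∀ k → Subj Δ k → (Arg k Δ Γ → Term Δ (Ext k Γ) ◇ → Set) → Set
  Commits T k a P = ∃ λ T' → T ⟶* T' × Σ (T' ↓ k ∙ a) λ d → ∀ x → P x (result d x)

  links-commit : {T U : Term Δ Γ ◇} → Star Link T U → ∀ {T' k a} → T ⟶* T' → (d : T' ↓ k ∙ a) →
    Commits U k a λ x R → result d x ≣ R
  links-commit ε rs d = _ , rs , d , λ x → ≣-refl
  links-commit (fwd p ◅ ps) rs d with ⊳-head* p rs
  ... | _ , rs' , p' with ⊳-commit p' d
  ...   | d' , h with links-commit ps rs' d'
  ...     | _ , rs'' , d'' , h' = _ , rs'' , d'' , λ x → ≣-trans (⊳⇒≣ (h x)) (h' x)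
  links-commit (bwd p ◅ ps) {k = k} rs d with ⇛-commit (⇛-head* p rs) d
  ... | _ , rs' , d' , h with links-commit ps rs' d'
  ...   | _ , rs'' , d'' , h' = _ , rs'' , d'' , λ x → ≣-trans (≣-sym (⇛⇒≣ (h (arg-refl k x)))) (h' x)
    where
    arg-refl : ∀ k (x : Arg k Δ Γ) → ArgRel _⇛_ k x x
    arg-refl (rcv s) x = tt
    arg-refl (snd s) x = ⇛-refl
    arg-refl tau     x = tt

  ≣-commit : {T U : Term Δ Γ ◇} → T ≣ U → ∀ {T' k a} → T ⟶* T' → (d : T' ↓ k ∙ a) →
    Commits U k a λ x R → result d x ≣ R
  ≣-commit p = links-commit (proj₁ (≣⇒links p))

  -- Commitments and labelled transitions

  ν*-cong : ∀ Θ {T U : Term (Θ ʳ++ Δ) Γ ◇} → T ≣ U → ν* Θ T ≣ ν* Θ U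
  ν*-cong []      p = p
  ν*-cong (s ∷ Θ) p = ν-cong (ν*-cong Θ p)

  ν*-ren : ∀ Θ (ρ : Δ ⊆ Δ₁) (T : Term (Θ ʳ++ Δ) Γ ◇) → ren ρ id (ν* Θ T) ≡ ν* Θ (ren (lifts Θ ρ) id T)
  ν*-ren []      ρ T = refl
  ν*-ren (s ∷ Θ) ρ T = cong (ν s) (ν*-ren Θ (∷⁺ʳ s ρ) T)

  ν*-extrude : ∀ Θ {T : Term (Θ ʳ++ Δ) Γ ◇} (U : Term Δ Γ ◇) →
    ν* Θ (T ∥ ren (weakens Θ) id U) ≣ ν* Θ T ∥ U
  ν*-extrude []      U = ∥-cong ≣-refl (≡⇒≣ (ren-id (λ _ → refl) (λ _ → refl) U))
  ν*-extrude (s ∷ Θ) {T} U = ≣-trans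
    (ν-cong (≣-trans (ν*-cong Θ (∥-cong ≣-refl (≡⇒≣ (sym (ren-∘ (λ _ → refl) (λ _ → refl) U)))))
                     (ν*-extrude Θ (ren there id U))))
    ν-extrude

  ν-ν* : ∀ Θ (T : Term (Θ ʳ++ (s ∷ Δ)) Γ ◇) → ν s (ν* Θ T) ≣ ν* Θ (ν s (ren (moveOut Θ) id T))
  ν-ν* []      T = ν-cong (≡⇒≣ (sym (ren-id (λ _ → refl) (λ _ → refl) T)))
  ν-ν* (t ∷ Θ) T = ≣-trans ν-swap (ν-cong (≣-trans (ν-cong (≡⇒≣ (ν*-ren Θ swap T)))
    (≣-trans (ν-ν* Θ _) (ν*-cong Θ (ν-cong (≡⇒≣ (ren-∘ (λ _ → refl) (λ _ → refl) T)))))))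

  lifts-∘ : ∀ Θ {ρ : Δ ⊆ Δ₁} {ρ' : Δ₁ ⊆ Δ₂} {ρ'' : Δ ⊆ Δ₂} → ρ' ∘ ρ ≐ ρ'' → lifts Θ ρ' ∘ lifts Θ ρ ≐ lifts Θ ρ''
  lifts-∘ []      h = h
  lifts-∘ (s ∷ Θ) h = lifts-∘ Θ (∷⁺ʳ-∘ h)

  lifts-weakens : ∀ Θ (ρ : Δ ⊆ Δ₁) (x : s ∈ Δ) → lifts Θ ρ (weakens Θ x) ≡ weakens Θ (ρ x)
  lifts-weakens []      ρ x = refl
  lifts-weakens (t ∷ Θ) ρ x = lifts-weakens Θ (∷⁺ʳ t ρ) (there x)

  moveOut-lifts : ∀ Θ (x : t ∈ Θ ʳ++ Δ) → moveOut {s = s} Θ (lifts Θ there x) ≡ there x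
  moveOut-lifts []      x = refl
  moveOut-lifts (u ∷ Θ) x = trans (cong (moveOut Θ) (lifts-∘ Θ swap-∷⁺ʳ-there x)) (moveOut-lifts Θ x)

  moveOut-weakens : ∀ Θ (x : t ∈ Δ) → moveOut {s = s} Θ (weakens Θ (there x)) ≡ there (weakens Θ x)
  moveOut-weakens Θ x =
    trans (cong (moveOut Θ) (sym (lifts-weakens Θ there x))) (moveOut-lifts Θ (weakens Θ x))

  weakens-inj : ∀ Θ → Inj (weakens {Δ} Θ)
  weakens-inj []      eq = eq
  weakens-inj (s ∷ Θ) eq = there-injective (weakens-inj Θ eq)

  -- Accounts for `RES-send`: the object avoids the restricted name, so once that name has moved
  -- inside the extruded scopes it can be confined to the continuation.
  res-send-≣ : ∀ Θ (F : Term Δ (t ∷ []) ◇) (A : Closed (Θ ʳ++ Δ) t) (P : Closed (Θ ʳ++ (s ∷ Δ)) ◇) →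
    ν s (ν* Θ (ren (weakens Θ) id (renᵃ there id (snd t) F) [ ren (lifts Θ there) id A ] ∥ P)) ≣
    ν* Θ (ren (weakens Θ) id F [ A ] ∥ ν s (ren (moveOut Θ) id P))
  res-send-≣ Θ F A P =
    ≣-trans (ν-ν* Θ _) (ν*-cong Θ (≣-trans (ν-cong (∥-cong (≡⇒≣ eq) ≣-refl)) (⊳⇒≣ {f = exact} (⊳-extrudeʳ refl))))
    where
    eqF : ren (moveOut Θ) id (ren (weakens Θ) id (renᵃ there id (snd _) F)) ≡ ren there id (ren (weakens Θ) id F)
    eqF = trans (cong (λ G → ren (moveOut Θ) id (ren (weakens Θ) id G)) (renᵃ-there F))
            (trans (cong (ren (moveOut Θ) id) (ren-∘ (λ _ → refl) (λ _ → refl) F))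
              (ren-square (moveOut-weakens Θ) (λ _ → refl) F))
    eq : ren (moveOut Θ) id (ren (weakens Θ) id (renᵃ there id (snd _) F) [ ren (lifts Θ there) id A ]) ≡
         ren there id (ren (weakens Θ) id F [ A ])
    eq = trans (sym (renᶜ-[] (moveOut Θ) (ren (weakens Θ) id (renᵃ there id (snd _) F))))
           (trans (cong₂ _[_] eqF (ren-∘ (moveOut-lifts Θ) (λ _ → refl) A))
             (renᶜ-[] there (ren (weakens Θ) id F)))

  open-send-≣ : ∀ Θ (F : Term Δ (t ∷ []) ◇) (A : Closed (Θ ʳ++ (s ∷ Δ)) t) (P : Closed (Θ ʳ++ (s ∷ Δ)) ◇) →
    ν s (ν* Θ (ren (weakens Θ) id (renᵃ there id (snd t) F) [ A ] ∥ P)) ≣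
    ν* (s ∷ Θ) (ren (weakens (s ∷ Θ)) id F [ A ] ∥ P)
  open-send-≣ Θ F A P = ≡⇒≣ (cong (λ G → ν _ (ν* Θ (G [ A ] ∥ P)))
    (trans (cong (ren (weakens Θ) id) (renᵃ-there F)) (ren-∘ (λ _ → refl) (λ _ → refl) F)))

  par-send-≣ : ∀ Θ {T P : Closed (Θ ʳ++ Δ) ◇} (U : Closed Δ ◇) →
    ν* Θ (T ∥ P) ∥ U ≣ ν* Θ (T ∥ (P ∥ ren (weakens Θ) id U))
  par-send-≣ Θ U = ≣-trans (≣-sym (ν*-extrude Θ U)) (ν*-cong Θ ∥-assoc)

  par-recv-≣ : {R : Term Δ (s ∷ []) ◇} {A : Closed Δ s} {U : Closed Δ ◇} →
    (R ∥ ren id there U) [ A ] ≣ R [ A ] ∥ ren id id U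
  par-recv-≣ {U = U} = ∥-cong ≣-refl
    (≡⇒≣ (trans (there-[] U) (sym (ren-id (λ _ → refl) (λ _ → refl) U))))

  kind : ∀ {Θ} → Act Δ Θ → Kind
  kind τ                = tau
  kind (recv {s} a A)   = rcv s
  kind (send {s} Θ a A) = snd s

  subject : ∀ {Θ} (l : Act Δ Θ) → Subj Δ (kind l)
  subject τ            = tt
  subject (recv a A)   = a
  subject (send Θ a A) = a

  -- A commitment knows only what each receiver makes of an output, while a transition names the
  -- object and the extruded channels; the last clause identifies the two descriptions. For
  -- processes its right-hand side is `plug F Θ A P`, the form compared by `send-match`.
  Fits : ∀ {Θ} (l : Act Δ Θ) → Closed (Θ ʳ++ Δ) ◇ → Arg (kind l) Δ [] → Term Δ (Ext (kind l) []) ◇ → Set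
  Fits τ            P x R = R ≣ P
  Fits (recv a A)   P x R = R [ A ] ≣ P
  Fits (send Θ a A) P F R = R ≣ ν* Θ (ren (weakens Θ) id F [ A ] ∥ P)

  Fits-≣ : ∀ {Θ} (l : Act Δ Θ) {P P' x R R'} → R' ≣ R → P ≣ P' → Fits l P x R → Fits l P' x R'
  Fits-≣ τ            p q r = ≣-trans p (≣-trans r q)
  Fits-≣ (recv a A)   p q r = ≣-trans (≣-sub _ p) (≣-trans r q)
  Fits-≣ (send Θ a A) p q r = ≣-trans p (≣-trans r (ν*-cong Θ (∥-cong ≣-refl q)))

  Fits-par : ∀ {Θ} (l : Act Δ Θ) {P x R} (U : Closed Δ ◇) → Fits l P x R →
    Fits l (P ∥ ren (weakens Θ) id U) x (R ∥ wk (kind l) U)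
  Fits-par τ            U r = ∥-cong r (≡⇒≣ (sym (ren-id (λ _ → refl) (λ _ → refl) U)))
  Fits-par (recv a A)   {R = R} U r = ≣-trans (par-recv-≣ {R = R}) (∥-cong r ≣-refl)
  Fits-par (send Θ a A) U r = ≣-trans (∥-cong r ≣-refl) (par-send-≣ Θ U)

  trans⇒commits : ∀ {Θ} {l : Act Δ Θ} {P P'} → P —[ l ]→ P' → Commits P (kind l) (subject l) (Fits l P')
  trans⇒commits INP = _ , ε , inp , λ x → ≣-refl
  trans⇒commits (OUT {a = a} {A} {T}) = _ , ε , out , λ F →
    ∥-cong (≡⇒≣ (cong (_[ A ]) (sym (ren-id (λ _ → refl) (λ _ → refl) F)))) ≣-refl
  trans⇒commits (RES-τ t) with trans⇒commits t
  ... | _ , rs , d , h = _ , gmap (ν _) under-ν rs , res refl d , λ x → ν-cong (h tt)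
  trans⇒commits (RES-recv t) with trans⇒commits t
  ... | _ , rs , d , h = _ , gmap (ν _) under-ν rs , res refl d , λ x →
    ≣-trans (≡⇒≣ (ν-[] (result d tt))) (ν-cong (h tt))
  trans⇒commits (RES-send {Θ = Θ} {A = A} {T' = T'} t) with trans⇒commits t
  ... | _ , rs , d , h = _ , gmap (ν _) under-ν rs , res refl d , λ F →
    ≣-trans (ν-cong (h _)) (res-send-≣ Θ F A T')
  trans⇒commits (OPEN {Θ = Θ} {A = A} {T' = T'} _ t) with trans⇒commits t
  ... | _ , rs , d , h = _ , gmap (ν _) under-ν rs , res refl d , λ F →
    ≣-trans (ν-cong (h _)) (open-send-≣ Θ F A T')
  trans⇒commits (PAR {l = l} {U = U} t) with trans⇒commits t
  ... | _ , rs , d , h = _ , gmap (_∥ U) ∥ˡ rs , parˡ d , λ x → Fits-par l U (h x)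
  -- The receiver acts below the extruded names, as a weakened term. Its head steps and, by
  -- injectivity of weakening, its commitment are pulled back to `T`.
  trans⇒commits (COM {Θ = Θ} {a = a} {A = A} {T = T} t u) with trans⇒commits t | trans⇒commits u
  ... | _ , rs , c , hc | _ , rs' , d , hd with ⟶*-ren⁻¹ (weakens Θ) id T rs
  ...   | T₀ , rs₀ , refl with renᵈ⁻¹ (weakens Θ) id (weakens-inj Θ) T₀ c
  ...     | a₀ , c₀ , eq , eq' with renᶜ-inj (weakens-inj Θ) a₀ a eq
  ...       | refl with uip eq refl
  ...         | refl with eq'
  ...           | refl =
    _ , gmap (_∥ _) ∥ˡ rs₀ ◅◅ gmap (_ ∥_) ∥ʳ rs' , comˡ c₀ d , λ x →
    ≣-trans (hd (result c₀ tt)) (ν*-cong Θ (∥-cong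
      (≣-trans (≡⇒≣ (cong (_[ A ]) (sym (result-renᶜ (weakens Θ) c₀ tt)))) (hc tt)) ≣-refl))
  trans⇒commits (STRUCT {l = l} p t q) with trans⇒commits t
  ... | _ , rs , d , h with ≣-commit (≣-sym p) rs d
  ...   | _ , rs' , d' , h' = _ , rs' , d' , λ x → Fits-≣ l (≣-sym (h' x)) q (h x)

  data Same (x : s ∈ Δ) : t ∈ Δ → Set where
    same : Same x x

  -- `ρ` misses at most `x`. Hence a term either mentions `x` or comes from the source of `ρ`, which
  -- is the choice between `OPEN` and `RES-send`.
  Covers : s ∈ Δ₁ → Δ ⊆ Δ₁ → Set
  Covers {Δ₁ = Δ₁} x ρ = ∀ {t} (y : t ∈ Δ₁) → Same x y ⊎ ∃ λ y₀ → ρ y₀ ≡ y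

  covers-∷ : {x : s ∈ Δ₁} {ρ : Δ ⊆ Δ₁} → Covers x ρ → Covers (there {x = t} x) (∷⁺ʳ t ρ)
  covers-∷ c (here p) = inj₂ (here p , refl)
  covers-∷ c (there y) with c y
  ... | inj₁ same          = inj₁ same
  ... | inj₂ (y₀ , refl) = inj₂ (there y₀ , refl)

  covers-lifts : ∀ Θ {x : s ∈ Δ₁} {ρ : Δ ⊆ Δ₁} → Covers x ρ → Covers (weakens Θ x) (lifts Θ ρ)
  covers-lifts []      c = c
  covers-lifts (t ∷ Θ) c = covers-lifts Θ (covers-∷ c)

  covers-there : Covers {s} {s ∷ Δ} (here refl) there
  covers-there (here refl) = inj₁ same
  covers-there (there y)   = inj₂ (y , refl)

  chan-fn? : {x : s ∈ Δ₁} {ρ : Δ ⊆ Δ₁} → Covers x ρ → (a : Chan Δ₁ t) →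
    (∃ λ y → Same x y × a ≡ bound y) ⊎ ∃ λ a₀ → renᶜ ρ a₀ ≡ a
  chan-fn? c (free k) = inj₂ (free k , refl)
  chan-fn? c (bound y) with c y
  ... | inj₁ e          = inj₁ (y , e , refl)
  ... | inj₂ (y₀ , refl) = inj₂ (bound y₀ , refl)

  fn? : {x : s ∈ Δ₁} {ρ : Δ ⊆ Δ₁} → Covers x ρ → (T : Term Δ₁ Γ t) →
    x ∈fn T ⊎ ∃ λ T₀ → ren ρ id T₀ ≡ T
  fn? c 𝟎       = inj₂ (𝟎 , refl)
  fn? c (var x) = inj₂ (var x , refl)
  fn? c (inp a T) with chan-fn? c a | fn? c T
  ... | inj₁ (_ , same , refl) | _ = inj₁ inp-subject
  ... | inj₂ _ | inj₁ p = inj₁ (inp-cont p)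
  ... | inj₂ (a₀ , refl) | inj₂ (T₀ , refl) =
    inj₂ (inp a₀ T₀ , cong (inp _) (ren-ext (λ _ → refl) (∷⁺ʳ-id (λ _ → refl)) T₀))
  fn? c (out a O T) with chan-fn? c a | fn? c O | fn? c T
  ... | inj₁ (_ , same , refl) | _ | _ = inj₁ out-subject
  ... | inj₂ _ | inj₁ p | _ = inj₁ (out-object p)
  ... | inj₂ _ | inj₂ _ | inj₁ p = inj₁ (out-cont p)
  ... | inj₂ (a₀ , refl) | inj₂ (O₀ , refl) | inj₂ (T₀ , refl) = inj₂ (out a₀ O₀ T₀ , refl)
  fn? c (T ∥ U) with fn? c T | fn? c U
  ... | inj₁ p | _ = inj₁ (par-l p)
  ... | inj₂ _ | inj₁ p = inj₁ (par-r p)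
  ... | inj₂ (T₀ , refl) | inj₂ (U₀ , refl) = inj₂ (T₀ ∥ U₀ , refl)
  fn? c (ν s T) with fn? (covers-∷ c) T
  ... | inj₁ p = inj₁ (res p)
  ... | inj₂ (T₀ , refl) = inj₂ (ν s T₀ , refl)
  fn? c (lam e T) with fn? c T
  ... | inj₁ p = inj₁ (lam-body p)
  ... | inj₂ (T₀ , refl) = inj₂ (lam e T₀ , cong (lam e) (ren-ext (λ _ → refl) (∷⁺ʳ-id (λ _ → refl)) T₀))
  fn? c (app e T U) with fn? c T | fn? c U
  ... | inj₁ p | _ = inj₁ (app-l p)
  ... | inj₂ _ | inj₁ p = inj₁ (app-r p)
  ... | inj₂ (T₀ , refl) | inj₂ (U₀ , refl) = inj₂ (app e T₀ U₀ , refl)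

  -- Reconstructs the object and the extruded channels that the description by receivers conceals.
  commit⇒send : {P : Closed Δ ◇} {a : Chan Δ s} (d : P ↓ snd s ∙ a) →
    ∃ λ Θ → ∃ λ A → ∃ λ P' → P —[ send Θ a A ]→ P' ×
      (∀ F → result d F ≣ ν* Θ (ren (weakens Θ) id F [ A ] ∥ P'))
  commit⇒send (out {O = O} {T = T}) = [] , O , T , OUT , λ F →
    ∥-cong (≡⇒≣ (cong (_[ O ]) (sym (ren-id (λ _ → refl) (λ _ → refl) F)))) ≣-refl
  commit⇒send (parˡ {U = U} d) with commit⇒send d
  ... | Θ , A , P' , t , h = Θ , A , _ , PAR t , λ F → ≣-trans (∥-cong (h F) ≣-refl) (par-send-≣ Θ U)
  commit⇒send (parʳ {T = T} d) with commit⇒send d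
  ... | Θ , A , P' , t , h = Θ , A , _ , STRUCT ∥-comm (PAR t) ≣-refl , λ F →
    ≣-trans ∥-comm (≣-trans (∥-cong (h F) ≣-refl) (par-send-≣ Θ T))
  commit⇒send (res {s = s} refl d) with commit⇒send d
  ... | Θ , A , P' , t , h with fn? (covers-lifts Θ covers-there) A
  ...   | inj₁ p = s ∷ Θ , A , P' , OPEN p t , λ F → ≣-trans (ν-cong (h _)) (open-send-≣ Θ F A P')
  ...   | inj₂ (A₀ , refl) = Θ , A₀ , _ , RES-send t , λ F → ≣-trans (ν-cong (h _)) (res-send-≣ Θ F A₀ P')

  commit⇒recv : {P : Closed Δ ◇} {a : Chan Δ s} (d : P ↓ rcv s ∙ a) (A : Closed Δ s) →
    P —[ recv a A ]→ result d tt [ A ]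
  commit⇒recv inp A = INP
  commit⇒recv (parˡ d) A = STRUCT ≣-refl (PAR (commit⇒recv d A)) (≣-sym (par-recv-≣ {R = result d tt}))
  commit⇒recv (parʳ d) A = STRUCT ∥-comm (PAR (commit⇒recv d A))
    (≣-trans (≣-sym (par-recv-≣ {R = result d tt})) ∥-comm)
  commit⇒recv (res refl d) A =
    STRUCT ≣-refl (RES-recv (commit⇒recv d (ren there id A))) (≡⇒≣ (sym (ν-[] (result d tt))))

  com⇒τ : {P Q : Closed Δ ◇} {a : Chan Δ s} (c : P ↓ rcv s ∙ a) (d : Q ↓ snd s ∙ a) →
    P ∥ Q —[ τ ]→ result d (result c tt)
  com⇒τ c d with commit⇒send d
  ... | Θ , A , P' , t , h = STRUCT ≣-refl (COM (commit⇒recv (renᵈ (weakens Θ) id c) A) t)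
    (≣-trans (ν*-cong Θ (∥-cong (≡⇒≣ (cong (_[ A ]) (result-renᶜ (weakens Θ) c tt))) ≣-refl))
      (≣-sym (h (result c tt))))

  commit⇒τ : {P : Closed Δ ◇} (d : P ↓ tau ∙ tt) → P —[ τ ]→ result d tt
  commit⇒τ (parˡ {U = U} d) =
    STRUCT ≣-refl (PAR (commit⇒τ d)) (∥-cong ≣-refl (≡⇒≣ (ren-id (λ _ → refl) (λ _ → refl) U)))
  commit⇒τ (parʳ {T = T} d) = STRUCT ∥-comm (PAR (commit⇒τ d))
    (≣-trans (∥-cong ≣-refl (≡⇒≣ (ren-id (λ _ → refl) (λ _ → refl) T))) ∥-comm)
  commit⇒τ (res eq d) = RES-τ (commit⇒τ d)
  commit⇒τ (comˡ c d) = com⇒τ c d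
  commit⇒τ (comʳ d c) = STRUCT ∥-comm (com⇒τ c d) ≣-refl

  -- Closed terms in arbitrary contexts

  none : [] ⊆ Δ
  none ()

  emb : Closed [] t → Term Δ Γ t
  emb = ren none none

  emb-ren : (ρ : Δ ⊆ Δ₁) (ξ : Γ ⊆ Γ₁) (T : Closed [] t) → ren ρ ξ (emb T) ≡ emb T
  emb-ren ρ ξ T = ren-∘ (λ ()) (λ ()) T

  emb-sub : (σ : Sub Δ Γ Γ₁) (T : Closed [] t) → sub σ (emb T) ≡ emb T
  emb-sub σ T = trans (sub-ren {ξ' = none} {σ = λ ()} (λ ()) T) (cong emb (sub-var (λ ()) T))

  emb-lam : ∀ {α} {e : cod α ≡ t} (A : Closed [] (↑ α)) {T : Term Δ (↑ dom α ∷ Γ) t} → lam e T ≡ emb A →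
    ∃ λ T₀ → A ≡ lam e T₀ × T ≡ ren none (∷⁺ʳ _ none) T₀
  emb-lam (lam e T₀) refl = T₀ , refl , refl

  -- Forwarding triggers

  module Trigger {α : Abs} (e₀ : cod α ≡ ◇) (A : Closed [] (↑ α)) where

    -- Corr ρ m T U: U arises from T by replacing some occurrences of A by the
    -- trigger Tr_m and some calls A⟨B⟩ by m̄B.
    data Corr {Δ Δ' : Ctx} (ρ : Δ ⊆ Δ') (m : ↑ dom α ∈ Δ') {Γ : Ctx} : Term Δ Γ t → Term Δ' Γ t → Set where
      ∼-𝟎    : Corr ρ m 𝟎 𝟎
      ∼-var  : {x : t ∈ Γ} → Corr ρ m (var x) (var x)
      ∼-inp  : ∀ {a : Chan Δ s} {b T U} → renᶜ ρ a ≡ b → Corr ρ m T U → Corr ρ m (inp a T) (inp b U)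
      ∼-out  : ∀ {a : Chan Δ s} {b O O' T U} → renᶜ ρ a ≡ b → Corr ρ m O O' → Corr ρ m T U →
        Corr ρ m (out a O T) (out b O' U)
      ∼-par  : ∀ {T T' U U'} → Corr ρ m T T' → Corr ρ m U U' → Corr ρ m (T ∥ U) (T' ∥ U')
      ∼-ν    : ∀ {T U} → Corr (∷⁺ʳ s ρ) (there m) T U → Corr ρ m (ν s T) (ν s U)
      ∼-lam  : ∀ {β} {e : cod β ≡ t} {T U} → Corr ρ m T U → Corr ρ m (lam e T) (lam e U)
      ∼-app  : ∀ {β} {e : cod β ≡ t} {T T' U U'} → Corr ρ m T T' → Corr ρ m U U' →
        Corr ρ m (app e T U) (app e T' U')
      ∼-tr   : ∀ {T U} → T ≡ emb A → U ≡ Tr e₀ (bound m) → Corr ρ m T U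
      ∼-call : ∀ {T B B'} → T ≡ emb A → Corr ρ m B B' → Corr ρ m (app e₀ T B) (out (bound m) B' 𝟎)

    ∼-≡ : {ρ : Δ ⊆ Δ₁} {m : ↑ dom α ∈ Δ₁} {T T' : Term Δ Γ t} {U U' : Term Δ₁ Γ t} →
      T ≡ T' → U ≡ U' → Corr ρ m T U → Corr ρ m T' U'
    ∼-≡ refl refl p = p

    ∼-ren : {ρ : Δ ⊆ Δ₁} {m : ↑ dom α ∈ Δ₁} {ρ₁ : Δ ⊆ Δ₂} {ρ₂ : Δ₁ ⊆ Δ₃} {ρ' : Δ₂ ⊆ Δ₃} {ξ : Γ ⊆ Γ₁} →
      ρ' ∘ ρ₁ ≐ ρ₂ ∘ ρ → {T : Term Δ Γ t} {U : Term Δ₁ Γ t} →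
      Corr ρ m T U → Corr ρ' (ρ₂ m) (ren ρ₁ ξ T) (ren ρ₂ ξ U)
    ∼-ren h ∼-𝟎         = ∼-𝟎
    ∼-ren h ∼-var       = ∼-var
    ∼-ren h (∼-inp {a = a} refl p)   = ∼-inp (trans (renᶜ-∘ h a) (sym (renᶜ-∘ (λ _ → refl) a))) (∼-ren h p)
    ∼-ren h (∼-out {a = a} refl p q) =
      ∼-out (trans (renᶜ-∘ h a) (sym (renᶜ-∘ (λ _ → refl) a))) (∼-ren h p) (∼-ren h q)
    ∼-ren h (∼-par p q) = ∼-par (∼-ren h p) (∼-ren h q)
    ∼-ren {ρ = ρ} {ρ₁ = ρ₁} {ρ₂} {ρ'} h (∼-ν {s = s} p) = ∼-ν (∼-ren h' p)
      where
      h' : ∷⁺ʳ s ρ' ∘ ∷⁺ʳ s ρ₁ ≐ ∷⁺ʳ s ρ₂ ∘ ∷⁺ʳ s ρ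
      h' (here p)  = refl
      h' (there x) = cong there (h x)
    ∼-ren h (∼-lam p)   = ∼-lam (∼-ren h p)
    ∼-ren h (∼-app p q) = ∼-app (∼-ren h p) (∼-ren h q)
    ∼-ren h (∼-tr refl refl) = ∼-tr (emb-ren _ _ A) refl
    ∼-ren h (∼-call refl p)  = ∼-call (emb-ren _ _ A) (∼-ren h p)

    -- Nothing has to be replaced, so a term corresponds to its own renaming. The identity appears
    -- as `ξ ≐ id` because lifting `id` below a binder does not compute to `id`.
    ∼-refl : {ρ : Δ ⊆ Δ₁} {m : ↑ dom α ∈ Δ₁} {ξ : Γ ⊆ Γ} → ξ ≐ id →
      (T : Term Δ Γ t) → Corr ρ m T (ren ρ ξ T)
    ∼-refl h 𝟎           = ∼-𝟎
    ∼-refl h (var x)     = ∼-≡ refl (cong var (sym (h x))) ∼-var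
    ∼-refl h (inp a T)   = ∼-inp refl (∼-refl (∷⁺ʳ-id h) T)
    ∼-refl h (out a O T) = ∼-out refl (∼-refl h O) (∼-refl h T)
    ∼-refl h (T ∥ U)     = ∼-par (∼-refl h T) (∼-refl h U)
    ∼-refl h (ν s T)     = ∼-ν (∼-refl h T)
    ∼-refl h (lam e T)   = ∼-lam (∼-refl (∷⁺ʳ-id h) T)
    ∼-refl h (app e T U) = ∼-app (∼-refl h T) (∼-refl h U)

    ∼-emb : {ρ : Δ ⊆ Δ₁} {m : ↑ dom α ∈ Δ₁} (T : Closed [] t) → Corr ρ m {Γ} (emb T) (emb T)
    ∼-emb T = ∼-≡ refl (emb-ren _ _ T) (∼-refl (λ _ → refl) (emb T))

    ∼-liftᵛ : {ρ : Δ ⊆ Δ₁} {m : ↑ dom α ∈ Δ₁} {σ : Sub Δ Γ Γ₁} {σ' : Sub Δ₁ Γ Γ₁} →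
      (∀ {t} (x : t ∈ Γ) → Corr ρ m (σ x) (σ' x)) →
      ∀ {t} (x : t ∈ s ∷ Γ) → Corr ρ m (liftᵛ σ x) (liftᵛ σ' x)
    ∼-liftᵛ h (here p)  = ∼-var
    ∼-liftᵛ h (there x) = ∼-ren (λ _ → refl) (h x)

    ∼-sub : {ρ : Δ ⊆ Δ₁} {m : ↑ dom α ∈ Δ₁} {σ : Sub Δ Γ Γ₁} {σ' : Sub Δ₁ Γ Γ₁} →
      (∀ {t} (x : t ∈ Γ) → Corr ρ m (σ x) (σ' x)) →
      {T : Term Δ Γ t} {U : Term Δ₁ Γ t} → Corr ρ m T U → Corr ρ m (sub σ T) (sub σ' U)
    ∼-sub h ∼-𝟎             = ∼-𝟎
    ∼-sub h (∼-var {x = x}) = h x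
    ∼-sub h (∼-inp eq p)    = ∼-inp eq (∼-sub (∼-liftᵛ h) p)
    ∼-sub h (∼-out eq p q)  = ∼-out eq (∼-sub h p) (∼-sub h q)
    ∼-sub h (∼-par p q)     = ∼-par (∼-sub h p) (∼-sub h q)
    ∼-sub h (∼-ν p)         = ∼-ν (∼-sub (λ x → ∼-ren (λ _ → refl) (h x)) p)
    ∼-sub h (∼-lam p)       = ∼-lam (∼-sub (∼-liftᵛ h) p)
    ∼-sub h (∼-app p q)     = ∼-app (∼-sub h p) (∼-sub h q)
    ∼-sub h (∼-tr refl refl) = ∼-tr (emb-sub _ A) refl
    ∼-sub h (∼-call refl p)  = ∼-call (emb-sub _ A) (∼-sub h p)

    ∼-[] : {ρ : Δ ⊆ Δ₁} {m : ↑ dom α ∈ Δ₁} {T : Term Δ (s ∷ Γ) t} {U : Term Δ₁ (s ∷ Γ) t}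
      {B : Term Δ Γ s} {B' : Term Δ₁ Γ s} →
      Corr ρ m T U → Corr ρ m B B' → Corr ρ m (T [ B ]) (U [ B' ])
    ∼-[] p q = ∼-sub (λ { (here refl) → q ; (there x) → ∼-var }) p

    -- Head reduction up to answering calls on m

    -- Answers a call in place, with the server left out of sight; `answer-≣` recovers this from an
    -- actual communication. The continuation `𝟎` is that of the trigger body.
    data Call {Δ : Ctx} (m : ↑ dom α ∈ Δ) {Γ : Ctx} : Term Δ Γ t → Term Δ Γ t → Set where
      call-out : ∀ {B} → Call m (out (bound m) B 𝟎) (app e₀ (emb A) B)
      call-∥ˡ  : ∀ {T T' U} → Call m T T' → Call m (T ∥ U) (T' ∥ U)
      call-∥ʳ  : ∀ {T U U'} → Call m U U' → Call m (T ∥ U) (T ∥ U')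
      call-ν   : ∀ {T T'} → Call (there m) T T' → Call m (ν s T) (ν s T')

    data Evolve {Δ : Ctx} (m : ↑ dom α ∈ Δ) {Γ : Ctx} (T U : Term Δ Γ t) : Set where
      red  : T ⟶ U → Evolve m T U
      call : Call m T U → Evolve m T U

    Evolve* : (m : ↑ dom α ∈ Δ) → Term Δ Γ t → Term Δ Γ t → Set
    Evolve* m = Star (Evolve m)

    -- `A` need not be a syntactic abstraction and may itself head-reduce, whereas a trigger is
    -- already one and cannot follow. The obligation is then handed to the application around it; at
    -- type `◇` it cannot arise.
    data Hook {Δ Δ₁ : Ctx} (m : ↑ dom α ∈ Δ₁) {Γ : Ctx} : Term Δ Γ t → Term Δ₁ Γ t → Set where
      hook : ∀ {T U} → T ≡ emb A → U ≡ Tr e₀ (bound m) → Hook m T U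

    -- Once the trigger has been replaced by `A`, both sides run the same closed term on
    -- corresponding arguments: either the abstraction is applied on both sides or both copies of
    -- `A` take the same step.
    app-emb-head : {ρ : Δ ⊆ Δ₁} {m : ↑ dom α ∈ Δ₁} {e : cod α ≡ t} {T : Term Δ Γ (↑ α)} {B : Term Δ Γ (↑ dom α)} {T' : Term Δ Γ t} {B' : Term Δ₁ Γ (↑ dom α)} →
      T ≡ emb A → Corr ρ m B B' → app e T B ⟶ T' → ∃ λ U' → app e (emb A) B' ⟶ U' × Corr ρ m T' U'
    app-emb-head {B' = B'} eq q (head-β {e = e} {T = T} refl) with emb-lam A eq
    ... | T₀ , eqA , refl = _ , subst (λ F → app e F B' ⟶ T₁ [ B' ]) (cong emb (sym eqA)) (head-β refl) , ∼-[] p q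
      where
      T₁ = ren none (∷⁺ʳ _ none) T₀
      p : Corr _ _ T T₁
      p = ∼-≡ refl (ren-∘ (λ ()) (λ { (here p) → refl }) T₀) (∼-refl (λ _ → refl) T)
    app-emb-head refl q (appˡ r) with ⟶-ren⁻¹ none none A r
    ... | A' , r' , refl = _ , appˡ (⟶-ren _ _ r') , ∼-app (∼-emb A') q

    app-Tr-evolve : ∀ {m : ↑ dom α ∈ Δ} {e : cod α ≡ t} {B : Term Δ Γ (↑ dom α)} →
      Evolve* m (app e (Tr e₀ (bound m)) B) (app e (emb A) B)
    -- The application has type `cod α`, which is `◇` by `e₀`; so applying the trigger yields a
    -- process, namely a call that can be answered.
    app-Tr-evolve {e = e} with trans (sym e₀) e
    ... | refl with uip e e₀
    ...   | refl = red (head-β refl) ◅ call call-out ◅ ε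

    ∼-head : {ρ : Δ ⊆ Δ₁} {m : ↑ dom α ∈ Δ₁} {T T' : Term Δ Γ t} {U : Term Δ₁ Γ t} →
      Corr ρ m T U → T ⟶ T' → (∃ λ U' → Evolve* m U U' × Corr ρ m T' U') ⊎ Hook m T U
    ∼-head (∼-par p q) (∥ˡ r) with ∼-head p r
    ... | inj₁ (_ , rs , p') =
      inj₁ (_ , gmap (_∥ _) (λ { (red r) → red (∥ˡ r) ; (call c) → call (call-∥ˡ c) }) rs , ∼-par p' q)
    ∼-head (∼-par p q) (∥ʳ r) with ∼-head q r
    ... | inj₁ (_ , rs , q') =
      inj₁ (_ , gmap (_ ∥_) (λ { (red r) → red (∥ʳ r) ; (call c) → call (call-∥ʳ c) }) rs , ∼-par p q')
    ∼-head (∼-ν p) (under-ν r) with ∼-head p r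
    ... | inj₁ (_ , rs , p') =
      inj₁ (_ , gmap (ν _) (λ { (red r) → red (under-ν r) ; (call c) → call (call-ν c) }) rs , ∼-ν p')
    ∼-head (∼-app p q) (appˡ r) with ∼-head p r
    ... | inj₁ (_ , rs , p') = inj₁ (_ , gmap (λ T → app _ T _) (λ { (red r) → red (appˡ r) }) rs , ∼-app p' q)
    ... | inj₂ (hook eq refl) with app-emb-head eq q (appˡ r)
    ...   | _ , r' , p' = inj₁ (_ , app-Tr-evolve ◅◅ red r' ◅ ε , p')
    ∼-head (∼-app (∼-lam p) q) (head-β refl) = inj₁ (_ , red (head-β refl) ◅ ε , ∼-[] p q)
    ∼-head (∼-app (∼-tr eq refl) q) r@(head-β refl) with app-emb-head eq q r
    ... | _ , r' , p' = inj₁ (_ , app-Tr-evolve ◅◅ red r' ◅ ε , p')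
    ∼-head (∼-tr eq eq') r = inj₂ (hook eq eq')
    ∼-head (∼-call eq p) r with app-emb-head eq p r
    ... | _ , r' , p' = inj₁ (_ , call call-out ◅ red r' ◅ ε , p')

    ∼-head* : {ρ : Δ ⊆ Δ₁} {m : ↑ dom α ∈ Δ₁} {T T' : Term Δ Γ ◇} {U : Term Δ₁ Γ ◇} →
      Corr ρ m T U → T ⟶* T' → ∃ λ U' → Evolve* m U U' × Corr ρ m T' U'
    ∼-head* p ε = _ , ε , p
    ∼-head* p (r ◅ rs) with ∼-head p r
    ... | inj₁ (_ , es , p') with ∼-head* p' rs
    ...   | _ , es' , p'' = _ , es ◅◅ es' , p''

    renᵃ-∼ : {ρ : Δ ⊆ Δ₁} {m : ↑ dom α ∈ Δ₁} → ∀ k {x : Arg k Δ Γ} {y} →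
      ArgRel (Corr ρ m) k x y → ArgRel (Corr (∷⁺ʳ s ρ) (there m)) k (renᵃ there id k x) (renᵃ there id k y)
    renᵃ-∼ (rcv s) r = tt
    renᵃ-∼ (snd s) r = ∼-ren (λ _ → refl) r
    renᵃ-∼ tau     r = tt

    ∼-wk : {ρ : Δ ⊆ Δ₁} {m : ↑ dom α ∈ Δ₁} → ∀ k {T : Term Δ Γ ◇} {U} → Corr ρ m T U → Corr ρ m (wk k T) (wk k U)
    ∼-wk (rcv s) p = ∼-ren (λ _ → refl) p
    ∼-wk (snd s) p = p
    ∼-wk tau     p = p

    Related : (ρ : Δ ⊆ Δ₁) (m : ↑ dom α ∈ Δ₁) → ∀ {k a b} {T : Term Δ Γ ◇} {U : Term Δ₁ Γ ◇} →
      T ↓ k ∙ a → U ↓ k ∙ b → Set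
    Related ρ m {k} d d' = ∀ {x y} → ArgRel (Corr ρ m) k x y → Corr ρ m (result d x) (result d' y)

    -- Replaced occurrences are abstractions or applications on the left, and neither commits to
    -- anything; so every commitment of `T` uses prefixes that both sides share.
    ∼-commit : {ρ : Δ ⊆ Δ₁} {m : ↑ dom α ∈ Δ₁} {T : Term Δ Γ ◇} {U : Term Δ₁ Γ ◇} → Corr ρ m T U →
      ∀ {k a} (d : T ↓ k ∙ a) → Σ (U ↓ k ∙ renˢ ρ k a) (Related ρ m d)
    ∼-commit (∼-inp refl p) inp = inp , λ _ → p
    ∼-commit (∼-out refl p q) out = out , λ r → ∼-par (∼-[] r p) q
    ∼-commit (∼-par p q) (parˡ {k} d) with ∼-commit p d
    ... | d' , h = parˡ d' , λ r → ∼-par (h r) (∼-wk k q)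
    ∼-commit (∼-par p q) (parʳ {k} d) with ∼-commit q d
    ... | d' , h = parʳ d' , λ r → ∼-par (∼-wk k p) (h r)
    ∼-commit (∼-par p q) (comˡ c d) with ∼-commit p c | ∼-commit q d
    ... | c' , hc | d' , hd = comˡ c' d' , λ r → hd (hc tt)
    ∼-commit (∼-par p q) (comʳ d c) with ∼-commit q c | ∼-commit p d
    ... | c' , hc | d' , hd = comʳ d' c' , λ r → hd (hc tt)
    ∼-commit (∼-ν p) (res {k = k} {a} refl d) with ∼-commit p d
    ... | d' , h = res (renˢ-square (λ _ → refl) k a) d' , λ r → ∼-ν (h (renᵃ-∼ k r))

    ∼-head⁻¹ : {ρ : Δ ⊆ Δ₁} {m : ↑ dom α ∈ Δ₁} {T : Term Δ Γ t} {U U' : Term Δ₁ Γ t} →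
      Corr ρ m T U → U ⟶ U' → ∃ λ T' → T ⟶? T' × Corr ρ m T' U'
    ∼-head⁻¹ (∼-par p q) (∥ˡ r) with ∼-head⁻¹ p r
    ... | _ , r' , p' = _ , ?-map (_∥ _) ∥ˡ r' , ∼-par p' q
    ∼-head⁻¹ (∼-par p q) (∥ʳ r) with ∼-head⁻¹ q r
    ... | _ , r' , q' = _ , ?-map (_ ∥_) ∥ʳ r' , ∼-par p q'
    ∼-head⁻¹ (∼-ν p) (under-ν r) with ∼-head⁻¹ p r
    ... | _ , r' , p' = _ , ?-map (ν _) under-ν r' , ∼-ν p'
    ∼-head⁻¹ (∼-app p q) (appˡ r) with ∼-head⁻¹ p r
    ... | _ , r' , p' = _ , ?-map (λ T → app _ T _) appˡ r' , ∼-app p' q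
    ∼-head⁻¹ (∼-app (∼-lam p) q) (head-β refl) = _ , step (head-β refl) , ∼-[] p q
    -- The trigger contracts by itself and emits the call; the left side has nothing to do, and
    -- `∼-call` records the pending application.
    ∼-head⁻¹ (∼-app (∼-tr eq refl) q) (head-β refl) = _ , stay , ∼-call eq q
    ∼-head⁻¹ (∼-tr eq refl) ()

    ∼-head*⁻¹ : {ρ : Δ ⊆ Δ₁} {m : ↑ dom α ∈ Δ₁} {T : Term Δ Γ t} {U U' : Term Δ₁ Γ t} →
      Corr ρ m T U → U ⟶* U' → ∃ λ T' → T ⟶* T' × Corr ρ m T' U'
    ∼-head*⁻¹ p ε = _ , ε , p
    ∼-head*⁻¹ p (r ◅ rs) with ∼-head⁻¹ p r
    ... | _ , r' , p' with ∼-head*⁻¹ p' rs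
    ...   | _ , rs' , p'' = _ , ?⇒* r' ◅◅ rs' , p''

    Fresh : Δ ⊆ Δ₁ → ↑ dom α ∈ Δ₁ → Set
    Fresh {Δ} ρ m = (x : ↑ dom α ∈ Δ) → ρ x ≡ m → ⊥

    fresh-∷ : {ρ : Δ ⊆ Δ₁} {m : ↑ dom α ∈ Δ₁} → Fresh ρ m → Fresh (∷⁺ʳ s ρ) (there m)
    fresh-∷ f (there x) eq = f x (there-injective eq)

    fresh-chan : {ρ : Δ ⊆ Δ₁} {m : ↑ dom α ∈ Δ₁} → Fresh ρ m → (a : Chan Δ (↑ dom α)) → renᶜ ρ a ≡ bound m → ⊥
    fresh-chan f (bound x) eq = f x (bound-injective eq)

    -- An answer undoes a replacement, so the same `T` still corresponds. Freshness guarantees that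
    -- the output on `m` is a pending call and not an output of `T`.
    ∼-call⁻¹ : {ρ : Δ ⊆ Δ₁} {m : ↑ dom α ∈ Δ₁} → Fresh ρ m → {T : Term Δ Γ t} {U U' : Term Δ₁ Γ t} →
      Corr ρ m T U → Call m U U' → Corr ρ m T U'
    ∼-call⁻¹ f (∼-out {a = a} eq p q) call-out = ⊥-elim (fresh-chan f a eq)
    ∼-call⁻¹ f (∼-call refl p) call-out = ∼-app (∼-emb A) p
    ∼-call⁻¹ f (∼-par p q) (call-∥ˡ c) = ∼-par (∼-call⁻¹ f p c) q
    ∼-call⁻¹ f (∼-par p q) (call-∥ʳ c) = ∼-par p (∼-call⁻¹ f q c)
    ∼-call⁻¹ f (∼-ν p) (call-ν c) = ∼-ν (∼-call⁻¹ (fresh-∷ f) p c)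

    commitOf : {m : ↑ dom α ∈ Δ} {U U' : Term Δ Γ ◇} → Call m U U' → U ↓ snd (↑ dom α) ∙ bound m
    commitOf call-out    = out
    commitOf (call-∥ˡ c) = parˡ (commitOf c)
    commitOf (call-∥ʳ c) = parʳ (commitOf c)
    commitOf (call-ν c)  = res refl (commitOf c)

    -- The receiver is the body of the server, so receiving the object of a call has the effect of
    -- `Call`, up to the empty continuation of the trigger.
    result-commitOf : {m : ↑ dom α ∈ Δ} {U U' : Term Δ Γ ◇} (c : Call m U U') →
      result (commitOf c) (app e₀ (emb A) (var (here refl))) ≣ U'
    result-commitOf call-out = ≣-trans ∥-identity (app-cong (≡⇒≣ (emb-sub _ A)) ≣-refl)
    result-commitOf (call-∥ˡ c) = ∥-cong (result-commitOf c) ≣-refl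
    result-commitOf (call-∥ʳ c) = ∥-cong ≣-refl (result-commitOf c)
    result-commitOf (call-ν c) = ν-cong (≣-trans
      (≡⇒≣ (cong (λ F → result (commitOf c) (app e₀ F (var (here refl)))) (emb-ren _ _ A)))
      (result-commitOf c))

    data Calls (m : ↑ dom α ∈ Δ) {U : Term Δ Γ ◇} : ∀ {k b} → U ↓ k ∙ b → Set where
      calls : ∀ {U'} (c : Call m U U') → Calls m (commitOf c)

    -- Injectivity makes subjects that match on the right match on the left as well. `Calls` is
    -- indexed by the commitment itself, so the second outcome determines which output is made.
    ∼-commit⁻¹ : {ρ : Δ ⊆ Δ₁} {m : ↑ dom α ∈ Δ₁} → Inj ρ → Fresh ρ m →
      {T : Term Δ Γ ◇} {U : Term Δ₁ Γ ◇} → Corr ρ m T U → ∀ {k b} (d' : U ↓ k ∙ b) →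
      (∃ λ a → renˢ ρ k a ≡ b × Σ (T ↓ k ∙ a) λ d → Related ρ m d d') ⊎ Calls m d'
    ∼-commit⁻¹ i f (∼-inp eq p) inp = inj₁ (_ , eq , inp , λ _ → p)
    ∼-commit⁻¹ i f (∼-out eq p q) out = inj₁ (_ , eq , out , λ r → ∼-par (∼-[] r p) q)
    ∼-commit⁻¹ i f (∼-call eq p) out = inj₂ (calls call-out)
    ∼-commit⁻¹ i f (∼-par p q) (parˡ {k} d) with ∼-commit⁻¹ i f p d
    ... | inj₁ (a , eq , d' , h) = inj₁ (a , eq , parˡ d' , λ r → ∼-par (h r) (∼-wk k q))
    ... | inj₂ (calls c) = inj₂ (calls (call-∥ˡ c))
    ∼-commit⁻¹ i f (∼-par p q) (parʳ {k} d) with ∼-commit⁻¹ i f q d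
    ... | inj₁ (a , eq , d' , h) = inj₁ (a , eq , parʳ d' , λ r → ∼-par (∼-wk k p) (h r))
    ... | inj₂ (calls c) = inj₂ (calls (call-∥ʳ c))
    ∼-commit⁻¹ i f (∼-par p q) (comˡ c d) with ∼-commit⁻¹ i f q d | ∼-commit⁻¹ i f p c
    -- A call meets no receiver inside `U`: the inputs of `U` stem from `T`, whose channels avoid
    -- `m`.
    ... | inj₂ (calls _) | inj₁ (a , eq , _) = ⊥-elim (fresh-chan f a eq)
    ... | inj₁ (a , refl , d' , hd) | inj₁ (b , eq , c' , hc) with renᶜ-inj i b a eq
    ...   | refl = inj₁ (tt , refl , comˡ c' d' , λ r → hd (hc tt))
    ∼-commit⁻¹ i f (∼-par p q) (comʳ d c) with ∼-commit⁻¹ i f p d | ∼-commit⁻¹ i f q c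
    ... | inj₂ (calls _) | inj₁ (a , eq , _) = ⊥-elim (fresh-chan f a eq)
    ... | inj₁ (a , refl , d' , hd) | inj₁ (b , eq , c' , hc) with renᶜ-inj i b a eq
    ...   | refl = inj₁ (tt , refl , comʳ d' c' , λ r → hd (hc tt))
    ∼-commit⁻¹ {ρ = ρ} i f (∼-ν p) (res {k = k} {b} eq d) with ∼-commit⁻¹ (∷⁺ʳ-inj i) (fresh-∷ f) p d
    ... | inj₁ (c , eq' , d' , h) with renˢ-pullback ρ k b c (trans eq (sym eq'))
    ...   | a , eqa , eqb = inj₁ (a , eqb , res eqa d' , λ r → ∼-ν (h (renᵃ-∼ k r)))
    ∼-commit⁻¹ {ρ = ρ} i f (∼-ν p) (res {a = b} eq .(commitOf c)) | inj₂ (calls c) with renᶜ-inj there-inj b (bound _) eq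
    ... | refl with uip eq refl
    ...   | refl = inj₂ (calls (call-ν c))

  -- The server, its host and the bisimulation

  module Factorisation {α : Abs} (e₀ : cod α ≡ ◇) (A : Closed [] (↑ α)) where
    open Trigger e₀ A

    M : Type
    M = ↑ dom α

    -- The server !m(Z).A⟨Z⟩ unfolds by an internal communication before each
    -- input, hence the two states.
    data State : Set where
      idle ready : State

    private
      body : Term (◇ ∷ M ∷ []) (◇ ∷ []) ◇
      body = inp (renᶜ there newest) (var (there (here refl)) ∥
                 ren there (∷⁺ʳ _ there) (app e₀ (ren there there A) (var (here refl))))
               ∥ out newest (var (here refl)) 𝟎

      Q : Term (◇ ∷ M ∷ []) [] ◇
      Q = inp newest body

    -- The state `ready` is spelled out as the result of `unfold`, so that passing to it from `idle`
    -- is definitional.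
    server : State → Closed (M ∷ []) ◇
    server idle  = !inp newest (app e₀ (ren there there A) (var (here refl)))
    server ready = ν ◇ (body [ Q ] ∥ 𝟎)

    unfold : server idle ↓ tau ∙ tt
    unfold = res refl (comˡ inp out)

    accept : server ready ↓ rcv M ∙ newest
    accept = res refl (parˡ (parˡ inp))

    -- Unfolding has put a copy of `Q` behind the input on m; accepting releases it next to the
    -- remaining output of `Q`, and with the private channel these rebuild the idle server. The new
    -- instance of `A` does not mention that channel and leaves its scope.
    accept-result : result accept tt ≣ app e₀ (emb A) (var (here refl)) ∥ ren id there (server idle)
    accept-result = ≣-trans
      (ν-cong (≣-trans ∥-identity (≣-trans (∥-cong ∥-comm ≣-refl) (≣-trans ∥-assoc (∥-cong (≡⇒≣ eqP) (≡⇒≣ eqQ))))))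
      (⊳⇒≣ {f = exact} (⊳-extrudeʳ refl))
      where
      Z : Term Δ (M ∷ Γ) M
      Z = var (here refl)
      eqP : app e₀ (sub (liftᵛ (single Q)) (ren there (∷⁺ʳ _ there) (ren there there A))) Z ≡
        ren there id (app e₀ (emb A) Z)
      eqP = cong (λ F → app e₀ F Z)
        (trans (cong (λ F → sub (liftᵛ (single Q)) F)
                 (trans (cong (ren there (∷⁺ʳ _ there)) (ren-ext (λ ()) (λ ()) A)) (emb-ren there (∷⁺ʳ _ there) A)))
               (trans (emb-sub _ A) (sym (emb-ren there id A))))
      eqQ : ren id there Q ∥ ren id there (out newest Q 𝟎) ≡ ren (∷⁺ʳ _ id) there (Q ∥ out newest Q 𝟎)
      eqQ = ren-ext (λ x → sym (∷⁺ʳ-id (λ _ → refl) x)) (λ _ → refl) (Q ∥ out newest Q 𝟎)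

    server-head : ∀ i {X} → server i ⟶ X → ⊥
    server-head idle  (under-ν (∥ˡ ()))
    server-head idle  (under-ν (∥ʳ ()))
    server-head ready (under-ν (∥ˡ (∥ˡ ())))
    server-head ready (under-ν (∥ˡ (∥ʳ ())))
    server-head ready (under-ν (∥ʳ ()))

    data ServerCommit : ∀ i {k a} → server i ↓ k ∙ a → Set where
      unfolds : ServerCommit idle unfold
      accepts : ServerCommit ready accept

    server-commit : ∀ i {k a} (d : server i ↓ k ∙ a) → ServerCommit i d
    server-commit idle (res {a = a} eq (parˡ inp)) = ⊥-elim (newest≢there a eq)
    server-commit idle (res {a = a} eq (parʳ out)) = ⊥-elim (newest≢there a eq)
    server-commit idle (res refl (comˡ inp out)) = unfolds
    server-commit ready (res {a = a} eq (parˡ (parˡ inp))) with renᶜ-inj there-inj a newest eq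
    ... | refl with uip eq refl
    ...   | refl = accepts
    server-commit ready (res {a = a} eq (parˡ (parʳ out))) = ⊥-elim (newest≢there a eq)
    server-commit ready (res eq (parˡ (comˡ inp ())))

    host : State → Closed (M ∷ []) ◇ → Process
    host i U = ν M (U ∥ server i)

    infix 4 _∼_

    _∼_ : Term [] Γ t → Term (M ∷ []) Γ t → Set
    _∼_ = Corr there (here refl)

    -- A sequence of no τ-transitions cannot absorb a congruence, so one is kept at the end; as soon
    -- as a transition follows, `STRUCT` takes it in.
    Reach : Process → Process → Set
    Reach P Q = ∃ λ P' → P ⇒ P' × P' ≣ Q

    reach-trans : ∀ {P Q S} → Reach P Q → Reach Q S → Reach P S
    reach-trans (P' , ts , p) (_ , ε , q)        = P' , ts , ≣-trans p q
    reach-trans (P' , ts , p) (_ , u ◅ us , q) = _ , ts ◅◅ STRUCT p u ≣-refl ◅ us , q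

    reach-τ : ∀ {P Q S} → P —[ τ ]→ Q → Q ≣ S → Reach P S
    reach-τ t p = _ , t ◅ ε , p

    unfold-reach : ∀ i {U} → Reach (host i U) (host ready U)
    unfold-reach idle {U} = reach-τ (commit⇒τ (res refl (parʳ {T = U} unfold))) ≣-refl
    unfold-reach ready    = _ , ε , ≣-refl

    -- The restored server does not depend on the received object, so `result-∥` takes it out of the
    -- scopes around the call.
    answer-≣ : ∀ {U U'} (c : Call (here refl) U U') → result (commitOf c) (result accept tt) ≣ U' ∥ server idle
    answer-≣ c = ≣-trans (result-cong (commitOf c) accept-result)
      (≣-trans (⊳⇒≣ {f = exact} (result-∥ (commitOf c) _ _)) (∥-cong (result-commitOf c) ≣-refl))
      where
      result-cong : {T : Term Δ Γ ◇} {a : Chan Δ s} (d : T ↓ snd s ∙ a) {F G : Term Δ (s ∷ Γ) ◇} →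
        F ≣ G → result d F ≣ result d G
      result-cong (out {O = O}) p = ∥-cong (≣-sub (single O) p) ≣-refl
      result-cong (parˡ d)   p = ∥-cong (result-cong d p) ≣-refl
      result-cong (parʳ d)   p = ∥-cong ≣-refl (result-cong d p)
      result-cong (res eq d) p = ν-cong (result-cong d (≣-ren there _ p))

    -- A head step costs no transition since `≣` contains β. An answer costs one communication,
    -- preceded by an unfolding if the server is idle, and leaves the server idle.
    evolve-reach : ∀ i {U U'} → Evolve (here refl) U U' → ∃ λ j → Reach (host i U) (host j U')
    evolve-reach i (red r)  = i , _ , ε , ν-cong (∥-cong (⟶⇒≣ r) ≣-refl)
    evolve-reach i (call c) = idle , reach-trans (unfold-reach i)
      (reach-τ (commit⇒τ (res refl (comʳ (commitOf c) accept))) (ν-cong (answer-≣ c)))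

    evolve*-reach : ∀ i {U U'} → Evolve* (here refl) U U' → ∃ λ j → Reach (host i U) (host j U')
    evolve*-reach i ε = i , _ , ε , ≣-refl
    evolve*-reach i (s ◅ ss) with evolve-reach i s
    ... | j , r with evolve*-reach j ss
    ...   | j' , r' = j' , reach-trans r r'

    lift-commit : ∀ i {U k a} → U ↓ k ∙ renˢ there k a → host i U ↓ k ∙ a
    lift-commit i d = res refl (parˡ d)

    -- A silent commitment leaves the corresponding `T` where it is: the server unfolds or a call is
    -- answered. All others come from `U` alone and have a counterpart in `T`.
    data HostCommit (T : Process) (i : State) {U : Closed (M ∷ []) ◇} : ∀ {k a} → host i U ↓ k ∙ a → Set where
      visible : ∀ {k a} (d : T ↓ k ∙ a) (d' : U ↓ k ∙ renˢ there k a) → Related there (here refl) d d' →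
        HostCommit T i (lift-commit i {a = a} d')
      silent  : ∀ {j U'} {d : host i U ↓ tau ∙ tt} → T ∼ U' → result d tt ≣ host j U' → HostCommit T i d

    host-commit : ∀ i {T U} → T ∼ U → ∀ {k a} (d : host i U ↓ k ∙ a) → HostCommit T i d
    host-commit i p {k} {a} (res eq (parˡ d)) with ∼-commit⁻¹ there-inj (λ _ ()) p d
    ... | inj₁ (a' , refl , d' , h) with renˢ-inj there-inj k a a' eq
    ...   | refl with uip eq refl
    ...     | refl = visible d' d h
    host-commit i p {a = a} (res eq (parˡ _)) | inj₂ (calls c) = ⊥-elim (newest≢there a eq)
    host-commit i p {a = a} (res eq (parʳ d)) with server-commit i d
    ... | unfolds = silent {j = ready} p ≣-refl
    ... | accepts = ⊥-elim (newest≢there a eq)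
    host-commit i p (res eq (comˡ c d)) with server-commit i d
    ... | ()
    host-commit i p (res eq (comʳ d c)) with server-commit i c
    ... | accepts with ∼-commit⁻¹ there-inj (λ _ ()) p d
    ...   | inj₁ (a , eq' , _) = ⊥-elim (newest≢there a eq')
    ...   | inj₂ (calls c') = silent {j = idle} (∼-call⁻¹ (λ _ ()) p c') (ν-cong (answer-≣ c'))

    host-head* : ∀ i {U X} → host i U ⟶* X → ∃ λ U' → U ⟶* U' × X ≡ host i U'
    host-head* i ε = _ , ε , refl
    host-head* i (under-ν (∥ˡ r) ◅ rs) with host-head* i rs
    ... | _ , rs' , eq = _ , r ◅ rs' , eq
    host-head* i (under-ν (∥ʳ r) ◅ rs) = ⊥-elim (server-head i r)

    Fact : Rel Process 0ℓ
    Fact P Q = ∃ λ T → ∃ λ U → ∃ λ i → P ≣ T × T ∼ U × Q ≣ host i U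

    -- Keeps the two commitments instead of target processes: an output must be matched before the
    -- context is known, and related commitments supply the outcome for every context.
    record Answer (Q : Process) {Θ : Ctx} (l : Act [] Θ) (P' : Closed (Θ ʳ++ []) ◇) : Set where
      constructor answer
      field
        {T}     : Process
        {U}     : Closed (M ∷ []) ◇
        j       : State
        d       : T ↓ kind l ∙ subject l
        d'      : U ↓ kind l ∙ renˢ there (kind l) (subject l)
        related : Related there (here refl) d d'
        fits    : ∀ x → Fits l P' x (result d x)
        reach   : Reach Q (host j U)

    fact-left : ∀ {P Q Θ} {l : Act [] Θ} {P'} → Fact P Q → P —[ l ]→ P' → Answer Q l P'
    fact-left {l = l} (T , U , i , p , c , q) t with trans⇒commits t
    ... | _ , rs , d , h with ≣-commit p rs d
    ...   | _ , rs' , d' , h' with ∼-head* c rs'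
    ...     | _ , es , c' with ∼-commit c' d' | evolve*-reach i es
    ...       | d'' , h'' | j , r =
      answer j d' d'' h'' (λ x → Fits-≣ l (≣-sym (h' x)) ≣-refl (h x)) (reach-trans (_ , ε , q) r)

    data Reply (P : Process) : ∀ {Θ} (l : Act [] Θ) (Q' : Closed (Θ ʳ++ []) ◇) → Set where
      visible : ∀ {Θ} {l : Act [] Θ} {Q' T U} i (d : T ↓ kind l ∙ subject l)
        (d' : U ↓ kind l ∙ renˢ there (kind l) (subject l)) → Related there (here refl) d d' →
        (∀ x → Fits l Q' x (result (lift-commit i {a = subject l} d') x)) → P ≣ T → Reply P l Q'
      silent : ∀ {Q'} → Fact P Q' → Reply P τ Q'

    reply : ∀ i {P T U Θ} (l : Act [] Θ) {Q'} {d : host i U ↓ kind l ∙ subject l} → P ≣ T →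
      HostCommit T i d → (∀ x → Fits l Q' x (result d x)) → Reply P l Q'
    reply i τ            p (visible d d' h) k = visible i d d' h k p
    reply i τ            p (silent c q)     k = silent (_ , _ , _ , p , c , ≣-trans (≣-sym (k tt)) q)
    reply i (recv a B)   p (visible d d' h) k = visible i d d' h k p
    reply i (send Θ a B) p (visible d d' h) k = visible i d d' h k p

    fact-right : ∀ {P Q Θ} {l : Act [] Θ} {Q'} → Fact P Q → Q —[ l ]→ Q' → Reply P l Q'
    fact-right {l = l} (T , U , i , p , c , q) t with trans⇒commits t
    ... | _ , rs , d , h with ≣-commit q rs d
    ...   | _ , rs' , d' , h' with host-head* i rs'
    ...     | _ , rs'' , refl with ∼-head*⁻¹ c rs''
    ...       | _ , us , c' = reply i l (≣-trans p (⟶*⇒≣ us)) (host-commit i c' d')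
      (λ x → Fits-≣ l (≣-sym (h' x)) ≣-refl (h x))

    host-recv-≣ : ∀ j {U s a} (d : U ↓ rcv s ∙ renᶜ there a) (B : Closed [] s) →
      result (lift-commit j {a = a} d) tt [ B ] ≣ host j (result d tt [ ren there id B ])
    host-recv-≣ j d B = ≡⇒≣ (trans (ν-[] (result d tt ∥ ren id there (server j)))
      (cong (λ S → ν M (result d tt [ ren there id B ] ∥ S)) (there-[] (server j))))

    ∼-id : (T : Term [] Γ t) → T ∼ ren there id T
    ∼-id = ∼-refl (λ _ → refl)

    -- The context of `send-match` avoids m and so corresponds to itself inside the scope of m;
    -- hence outputs can be matched although the receiver comes to lie next to the server.
    ∼-arg : (F : Term [] (s ∷ []) ◇) → F ∼ renᵃ there id (snd s) F
    ∼-arg F = ∼-refl (∷⁺ʳ-id (λ _ → refl)) F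

    FactSym : Rel Process 0ℓ
    FactSym P Q = Fact P Q ⊎ Fact Q P

    factSym-bisimulation : IsContextBisimulation FactSym
    factSym-bisimulation = record
      { symmetric  = λ { (inj₁ f) → inj₂ f ; (inj₂ f) → inj₁ f }
      ; τ-match    = τ-match
      ; recv-match = recv-match
      ; send-match = send-match
      }
      where
      τ-match : ∀ {P Q P'} → FactSym P Q → P —[ τ ]→ P' → ∃ λ Q' → Q ⇒ Q' × FactSym P' Q'
      τ-match (inj₁ f) t with fact-left f t
      ... | answer j d d' h k (_ , ts , q) =
        _ , ts ◅◅ STRUCT q (commit⇒τ (lift-commit j d')) ≣-refl ◅ ε ,
        inj₁ (_ , _ , j , ≣-sym (k tt) , h tt , ≣-refl)
      τ-match (inj₂ f) t with fact-right f t
      ... | visible i d d' h k p =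
        _ , STRUCT p (commit⇒τ d) ≣-refl ◅ ε , inj₂ (_ , _ , i , ≣-refl , h tt , ≣-sym (k tt))
      ... | silent f' = _ , ε , inj₂ f'

      recv-match : ∀ {P Q P' s} {a : Chan [] s} {B} → FactSym P Q → P —[ recv a B ]→ P' →
        ∃ λ Q' → Q =[ recv a B ]⇒ Q' × FactSym P' Q'
      recv-match {a = a} {B} (inj₁ f) t with fact-left f t
      ... | answer j d d' h k (_ , ts , q) =
        _ , (_ , _ , ts , STRUCT q (commit⇒recv (lift-commit j d') B) ≣-refl , ε) ,
        inj₁ (_ , _ , j , ≣-sym (k tt) , ∼-[] (h tt) (∼-id B) , host-recv-≣ j {a = a} d' B)
      recv-match {a = a} {B} (inj₂ f) t with fact-right f t
      ... | visible i d d' h k p =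
        _ , (_ , _ , ε , STRUCT p (commit⇒recv d B) ≣-refl , ε) ,
        inj₂ (_ , _ , i , ≣-refl , ∼-[] (h tt) (∼-id B) , ≣-trans (≣-sym (k tt)) (host-recv-≣ i {a = a} d' B))

      send-match : ∀ {P Q s Θ} {a : Chan [] s} {B P'} → FactSym P Q → P —[ send Θ a B ]→ P' →
        ∃ λ Θ' → ∃ λ B' → ∃ λ Q' → Q =[ send Θ' a B' ]⇒ Q' ×
          (∀ (E : Term [] (s ∷ []) ◇) → FactSym (plug E Θ B P') (plug E Θ' B' Q'))
      send-match (inj₁ f) t with fact-left f t
      ... | answer j d d' h k (_ , ts , q) with commit⇒send (lift-commit j d')
      ...   | Θ' , B' , Q' , u , g =
        Θ' , B' , Q' , (_ , _ , ts , STRUCT q u ≣-refl , ε) ,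
        -- `k E` and `g E` identify the plugged processes with the results of the two commitments at
        -- receiver `E`.
        λ E → inj₁ (_ , _ , j , ≣-sym (k E) , h (∼-arg E) , ≣-sym (g E))
      send-match (inj₂ f) t with fact-right f t
      ... | visible i d d' h k p with commit⇒send d
      ...   | Θ' , B' , Q' , u , g =
        Θ' , B' , Q' , (_ , _ , ε , STRUCT p u ≣-refl , ε) ,
        λ E → inj₂ (_ , _ , i , ≣-sym (g E) , h (∼-arg E) , ≣-sym (k E))

    fact⇒≈ : ∀ {P Q} → Fact P Q → P ≈ᵖ Q
    fact⇒≈ f = FactSym , factSym-bisimulation , inj₁ f

  -- Open terms and abstractions

  instantiate-≣ : ∀ {α} (F : Closed Δ (↑ α)) B → instantiate F B ≣ app refl F B
  instantiate-≣ (lam refl T) B = ≣-sym β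
  instantiate-≣ (app e F G)  B = ≣-refl

  liftᵛ* : ∀ Ψ → Sub Δ Γ Γ₁ → Sub Δ (Ψ ʳ++ Γ) (Ψ ʳ++ Γ₁)
  liftᵛ* []      σ = σ
  liftᵛ* (s ∷ Ψ) σ = liftᵛ* Ψ (liftᵛ σ)

  sub-lam* : ∀ {Ψ} (p : Params Ψ t) (σ : Sub Δ Γ Γ₁) (T : Term Δ (Ψ ʳ++ Γ) ◇) →
    sub σ (lam* p T) ≡ lam* p (sub (liftᵛ* Ψ σ) T)
  sub-lam* []      σ T = refl
  sub-lam* (e ∷ p) σ T = cong (lam e) (sub-lam* p (liftᵛ σ) T)

  liftᵛ*-weakens : ∀ Ψ (σ : Sub Δ Γ Γ₁) (T : Term Δ Γ t) →
    sub (liftᵛ* Ψ σ) (ren id (weakens Ψ) T) ≡ ren id (weakens Ψ) (sub σ T)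
  liftᵛ*-weakens []      σ T = sub-ren (λ x → sym (ren-id (λ _ → refl) (λ _ → refl) (σ x))) T
  liftᵛ*-weakens (s ∷ Ψ) σ T =
    trans (cong (sub (liftᵛ* Ψ (liftᵛ σ))) (sym (ren-∘ (λ _ → refl) (λ _ → refl) T)))
      (trans (liftᵛ*-weakens Ψ (liftᵛ σ) (ren id there T))
        (trans (cong (ren id (weakens Ψ)) (sub-ren {ξ' = there} {σ = σ} {σ' = liftᵛ σ} (λ _ → refl) T))
               (ren-∘ (λ _ → refl) (λ _ → refl) (sub σ T))))

  liftᶜ-liftᵛ : {σ : Sub Δ Γ Γ₁} {σ' : Sub (s ∷ Δ) Γ Γ₁} → liftᶜ σ ≐ˢ σ' → liftᶜ (liftᵛ {s = t} σ) ≐ˢ liftᵛ σ'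
  liftᶜ-liftᵛ h (here p) = refl
  liftᶜ-liftᵛ {σ = σ} h (there x) =
    trans (ren-square (λ _ → refl) (λ _ → refl) (σ x)) (cong (ren id there) (h x))

  liftᶜ-liftᵛ* : ∀ Ψ {σ : Sub Δ Γ Γ₁} {σ' : Sub (s ∷ Δ) Γ Γ₁} → liftᶜ σ ≐ˢ σ' →
    liftᶜ (liftᵛ* Ψ σ) ≐ˢ liftᵛ* Ψ σ'
  liftᶜ-liftᵛ* []      h = h
  liftᶜ-liftᵛ* (t ∷ Ψ) {σ} h = liftᶜ-liftᵛ* Ψ (liftᶜ-liftᵛ {σ = σ} h)

  sub-!inp : (σ : Sub Δ Γ Γ₁) (a : Chan Δ s) (P : Term Δ (s ∷ Γ) ◇) →
    sub σ (!inp a P) ≡ !inp a (sub (liftᵛ σ) P)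
  sub-!inp {Δ = Δ} {Γ₁ = Γ₁} {s = s} σ a P = cong (λ P' → ν ◇ (Q P' ∥ out newest (Q P') 𝟎)) (sub-ren h P)
    where
    Q : Term (◇ ∷ Δ) (s ∷ ◇ ∷ Γ₁) ◇ → Term (◇ ∷ Δ) Γ₁ ◇
    Q P' = inp newest (inp (renᶜ there a) (var (there (here refl)) ∥ P') ∥ out newest (var (here refl)) 𝟎)
    h : ∀ {t} (x : t ∈ s ∷ _) →
      liftᵛ (liftᵛ (liftᶜ σ)) (∷⁺ʳ s there x) ≡ ren there (∷⁺ʳ s there) (liftᵛ σ x)
    h (here p)  = refl
    h (there x) = trans (cong (ren id there) (ren-∘ (λ _ → refl) (λ _ → refl) (σ x)))
      (ren-square (λ _ → refl) (λ _ → refl) (σ x))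

  sub-serve : ∀ {α} (e : cod α ≡ ◇) (σ : Sub Δ Γ Γ₁) (A : Term Δ Γ (↑ α)) (T : Term (↑ dom α ∷ Δ) Γ ◇) →
    sub σ (serve e A T) ≡ serve e (sub σ A) (sub (liftᶜ σ) T)
  sub-serve e σ A T = cong (λ S → ν _ (sub (liftᶜ σ) T ∥ S))
    (trans (sub-!inp (liftᶜ σ) newest (app e (ren there there A) (var (here refl))))
      (cong (λ F → !inp newest (app e F (var (here refl))))
        (sub-ren {ξ = there} {σ' = liftᵛ (liftᶜ σ)} (λ x → ren-∘ (λ _ → refl) (λ _ → refl) (σ x)) A)))

  ≈ᶜ-≡ : {T T' U U' : Closed [] t} → T ≡ T' → U ≡ U' → T' ≈ᶜ U' → T ≈ᶜ U
  ≈ᶜ-≡ refl refl p = p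

  emb-closed : (T : Closed [] t) → emb T ≡ T
  emb-closed = ren-id (λ ()) (λ ())

  module _ {α : Abs} (e : cod α ≡ ◇) (A : Closed [] (↑ α)) where
    open Trigger e A
    open Factorisation e A

    ∼⇒≈ : ∀ {Ψ} (p : Params Ψ t) {T T' : Closed [] t} {U W} → T' ≣ T → T ∼ U → U ≣ lam* p W →
      T' ≈ᶜ lam* p (serve e (emb A) W)
    ∼⇒≈ [] {W = W} r c q = ≈ᶜ-≡ refl (cong (λ F → serve e F W) (emb-closed A))
      (proc (fact⇒≈ (_ , _ , idle , r , c , ν-cong (∥-cong (≣-sym q) ≣-refl))))
    ∼⇒≈ {Ψ = _ ∷ Ψ} (refl ∷ p) {T} {T'} {U} {W} r c q = abst λ B →
      ≈ᶜ-≡ refl (trans (sub-lam* p (single B) _) (cong (lam* p)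
          (trans (sub-serve e (liftᵛ* Ψ (single B)) (emb A) W)
            (cong₂ (serve e) (emb-sub _ A) (sub-ext (liftᶜ-liftᵛ* Ψ single-liftᶜ) W)))))
        (∼⇒≈ p (≣-trans (instantiate-≣ T' B) (app-cong r ≣-refl)) (∼-app c (∼-id B))
          (≣-trans (app-cong q ≣-refl) (≣-trans β (≡⇒≣ (sub-lam* p (single (ren there id B)) W)))))
      where
      single-liftᶜ : {B : Closed [] s} → liftᶜ {s = u} (single B) ≐ˢ single (ren there id B)
      single-liftᶜ (here refl) = refl

  -- Closing by `σ` also instantiates `A`, so the correspondence is taken at `sub σ A`; the hole of
  -- `E` is the only place where a replacement is made.
  sub-∼ : ∀ {α} (e : cod α ≡ ◇) (σ : Sub [] Γ []) (A : Term [] Γ (↑ α)) (E : Term [] (↑ α ∷ Γ) t) →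
    Factorisation._∼_ e (sub σ A) (sub σ (E [ A ])) (sub (liftᶜ σ) (E [Tr e ]))
  sub-∼ e σ A E = ∼-≡ (sym (sub-∘ (λ _ → refl) E)) (sym (sub-∘ (λ _ → refl) (ren there id E))) (∼-sub h (∼-id E))
    where
    open Trigger e (sub σ A)
    open Factorisation e (sub σ A)
    h : ∀ {t} (x : t ∈ _) → sub σ (single A x) ∼ sub (liftᶜ σ) (single (Tr e newest) x)
    h (here refl) = ∼-tr (sym (emb-closed (sub σ A))) refl
    h (there x)   = ∼-id (σ x)

  sub-factor : ∀ {α} (e : cod α ≡ ◇) {Ψ} (p : Params Ψ t) (σ : Sub [] Γ []) (A : Term [] Γ (↑ α)) W →
    sub σ (lam* p (serve e (ren id (weakens Ψ) A) W)) ≡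
    lam* p (serve e (emb (sub σ A)) (sub (liftᵛ* Ψ (liftᶜ σ)) W))
  sub-factor e {Ψ} p σ A W = trans (sub-lam* p σ _) (cong (lam* p)
    (trans (sub-serve e (liftᵛ* Ψ σ) (ren id (weakens Ψ) A) W) (cong₂ (serve e)
      (trans (liftᵛ*-weakens Ψ σ A) (ren-ext (λ ()) (λ ()) (sub σ A)))
      (sub-ext (liftᶜ-liftᵛ* Ψ (λ _ → refl)) W))))

  -- Covers both claims at once, since for empty `p` the term is a process and `lam*` adds nothing.
  factorisation : ∀ {α} (e : cod α ≡ ◇) (A : Term [] Γ (↑ α)) (E : Term [] (↑ α ∷ Γ) t) {Ψ} (p : Params Ψ t) W →
    E [Tr e ] ≣ lam* p W → E [ A ] ≈ lam* p (serve e (ren id (weakens Ψ) A) W)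
  factorisation e A E p W q σ = ≈ᶜ-≡ refl (sub-factor e p σ A W)
    (∼⇒≈ e (sub σ A) p ≣-refl (sub-∼ e σ A E) (≣-trans (≣-sub (liftᶜ σ) q) (≡⇒≣ (sub-lam* p (liftᶜ σ) W))))

  factorisation-◇ : ∀ {α} (e : cod α ≡ ◇) (A : Term [] Γ (↑ α)) (E : Term [] (↑ α ∷ Γ) ◇) → E [ A ] ≈ serve e A (E [Tr e ])
  -- For empty `p` the weakening of `A` is a renaming by `id`, equal to `A` only propositionally.
  factorisation-◇ e A E σ = ≈ᶜ-≡ refl (cong (λ F → sub σ (serve e F (E [Tr e ]))) (sym (ren-id (λ _ → refl) (λ _ → refl) A)))
    (factorisation e A E [] (E [Tr e ]) ≣-refl σ)

theorem2 : (𝒯 : TypeStructure) → let open Calculus 𝒯 in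
  (Γ : List Abs) (α : Abs) (e : cod α ≡ ◇) (A : Term [] (vars Γ) (↑ α)) →
  ((E : Term [] (↑ α ∷ vars Γ) ◇) →
    E [ A ] ≈ serve e A (E [Tr e ]))
  ×
  ((β : Abs) (E : Term [] (↑ α ∷ vars Γ) (↑ β))
    (Ψ : Ctx) (p : Params Ψ (↑ β))
    (E' : Term (↑ dom α ∷ []) (Ψ ʳ++ vars Γ) ◇) →
    E [Tr e ] ≣ lam* p E' →
    E [ A ] ≈ lam* p (serve e (ren id (weakens Ψ) A) E'))
theorem2 𝒯 Γ α e A =
  (λ E σ → Proof.factorisation-◇ 𝒯 e A E σ) ,
  (λ β E Ψ p E' q → Proof.factorisation 𝒯 e A E p E' q)
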